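{- Let $n\ge 3$ and let $f\in\mathrm{Per}(\mathbb{F}_2^n)\setminus \mathrm{AGL}(n,\mathbb{F}_2)$. Then \[2\text{ -coaffinity}(f)\ge \tfrac{8}{3}(2^{n-1}-1)(2^{n-2}-1).\] Moreover, letting $\tau\in\mathrm{Per}(\mathbb{F}_2^n)$ be any transposition, equality holds if and only if $f\in \mathrm{AGL}(n,\mathbb{F}_2)\circ\tau\circ\mathrm{AGL}(n,\mathbb{F}_2)$.
   Context: $\mathrm{Per}(\mathbb{F}_2^n)$ is the group of all permutations of $\mathbb{F}_2^n$, and $\mathrm{AGL}(n,\mathbb{F}_2)$ is the group of invertible affine maps $x\mapsto xA+b$ ($A\in\mathrm{GL}(n,\mathbb{F}_2)$, $b\in\mathbb{F}_2^n$). A $2$-flat of $\mathbb{F}_2^n$ is a coset of a $2$-dimensional linear subspace (equivalently a 4-element set $\{x_1,x_2,x_3,x_4\}$ with $x_1+x_2+x_3+x_4=0$). For $f\in\mathrm{Per}(\mathbb{F}_2^n)$, $2\text{ -coaffinity}(f)$ is the number of $2$-flats $X$ such that $f(X)$ is not a $2$-flat. A transposition is a permutation interchanging two distinct points and fixing all others. $\mathrm{AGL}\circ\tau\circ\mathrm{AGL}$ denotes $\{\alpha\circ\tau\circ\beta:\alpha,\beta\in\mathrm{AGL}(n,\mathbb{F}_2)\}$. -}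

module Defs where

open import Data.Bool using (Bool; true; false; _xor_; if_then_else_)
open import Data.Bool.Properties using () renaming (_≟_ to _≟B_)
open import Data.Nat using (ℕ; zero; suc; _/_)
open import Data.Vec using (Vec; []; _∷_; replicate; zipWith)
open import Data.Vec.Properties using (≡-dec)
open import Data.List using (List; []; _∷_; map; concatMap; length; filter)
open import Data.Product using (Σ; ∃; _×_; _,_)
open import Relation.Binary.PropositionalEquality using (_≡_; _≢_)
open import Relation.Nullary using (Dec; ¬_; yes; no)
open import Relation.Nullary.Decidable using (_×-dec_; ¬?)
open import Relation.Binary using (DecidableEquality)

-- Points of F_2^n : bit vectors of length n (xor = addition in F_2)
Pt : ℕ → Set
Pt n = Vec Bool n

_≟P_ : ∀ {n} → DecidableEquality (Pt n)
_≟P_ = ≡-dec _≟B_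

infixl 6 _⊕_
_⊕_ : ∀ {n} → Pt n → Pt n → Pt n
_⊕_ = zipWith _xor_

𝟘 : ∀ {n} → Pt n
𝟘 = replicate _ false

-- n×n matrices over F_2, given as the list of their rows
Mat : ℕ → Set
Mat n = Vec (Vec Bool n) n

vecMat : ∀ {m n} → Vec Bool m → Vec (Vec Bool n) m → Vec Bool n
vecMat [] [] = 𝟘
vecMat (xi ∷ x) (r ∷ A) = if xi then r ⊕ vecMat x A else vecMat x A

IsInvertible : ∀ {n} → Mat n → Set
IsInvertible {n} A = ∃ λ (B : Mat n) →
  (∀ x → vecMat (vecMat x A) B ≡ x) × (∀ x → vecMat (vecMat x B) A ≡ x)

IsAffine : ∀ {n} → (Pt n → Pt n) → Set
IsAffine {n} g = Σ (Mat n) λ A → Σ (Pt n) λ b →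
  IsInvertible A × (∀ x → g x ≡ vecMat x A ⊕ b)

swap : ∀ {n} → Pt n → Pt n → Pt n → Pt n
swap a b x with x ≟P a
... | yes _ = b
... | no _ with x ≟P b
...   | yes _ = a
...   | no _ = x

InDoubleCoset : ∀ {n} → (Pt n → Pt n) → (Pt n → Pt n) → Set
InDoubleCoset {n} τ f = Σ (Pt n → Pt n) λ α → Σ (Pt n → Pt n) λ β →
  IsAffine α × IsAffine β × (∀ x → f x ≡ α (τ (β x)))

allPts : (n : ℕ) → List (Pt n)
allPts zero = [] ∷ []
allPts (suc n) = concatMap (λ v → (false ∷ v) ∷ (true ∷ v) ∷ []) (allPts n)

Quad : ℕ → Set
Quad n = Pt n × Pt n × Pt n × Pt n

allQuads : (n : ℕ) → List (Quad n)
allQuads n = concatMap (λ a → concatMap (λ b → concatMap (λ c →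
  map (λ d → (a , b , c , d)) (allPts n)) (allPts n)) (allPts n)) (allPts n)

Distinct4 : ∀ {n} → Quad n → Set
Distinct4 (a , b , c , d) = a ≢ b × a ≢ c × a ≢ d × b ≢ c × b ≢ d × c ≢ d

distinct4? : ∀ {n} (q : Quad n) → Dec (Distinct4 q)
distinct4? (a , b , c , d) =
  ¬? (a ≟P b) ×-dec ¬? (a ≟P c) ×-dec ¬? (a ≟P d) ×-dec
  ¬? (b ≟P c) ×-dec ¬? (b ≟P d) ×-dec ¬? (c ≟P d)

Is2Flat : ∀ {n} → Quad n → Set
Is2Flat (a , b , c , d) = Distinct4 (a , b , c , d) × (a ⊕ b ⊕ c ⊕ d ≡ 𝟘)

is2Flat? : ∀ {n} (q : Quad n) → Dec (Is2Flat q)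
is2Flat? (a , b , c , d) = distinct4? (a , b , c , d) ×-dec ((a ⊕ b ⊕ c ⊕ d) ≟P 𝟘)

image : ∀ {n} → (Pt n → Pt n) → Quad n → Quad n
image f (a , b , c , d) = (f a , f b , f c , f d)

-- 2-coaffinity(f): number of 2-flats X with f(X) not a 2-flat.
-- Each 4-element set is listed by 4! = 24 orderings, hence the division.
coaffinity2 : ∀ {n} → (Pt n → Pt n) → ℕ
coaffinity2 {n} f =
  length (filter (λ q → is2Flat? q ×-dec ¬? (is2Flat? (image f q))) (allQuads n)) / 24

{-# OPTIONS --safe #-}

-- A bad 2-flat of f is bad for exactly half of the components v·f, so the coaffinity of f is
-- (2/N) times the sum over v of the number of flats on which v·f has sum 1, where N = 2ⁿ.
-- Fix v₀ with v₀·f not affine: of v·f and (v + v₀)·f at least one is not affine, so it suffices to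
-- show that a nonaffine Boolean function g of even weight has at least (N-2)(N-4)/3 bad flats.
-- That number is determined by the fourth moment of the Walsh transform W of g. The values of W are
-- divisible by 4 and satisfy ∑ W² = N² and |W(u)| + |W(v)| ≤ N for u ≠ v, hence ∑ W⁴ is maximal
-- when some |W(u)| equals N - 4, that is when g differs from an affine function at two points.
-- In the case of equality, f = L + e·(δ_a + δ_b) with L affine, and bijectivity of f forces f to
-- be L composed with the transposition of a and b. AGL(n, 2) acts 2-transitively on points, so
-- every transposition gives the same double coset.
module Submission where

open import Defs
open import Algebra.Structures using (IsCommutativeSemiring)
open import Data.Bool using (Bool; true; false; not; _∧_; if_then_else_) renaming (_xor_ to infixl 6 _xor_)
import Data.Bool.Properties as Boolₚ
import Data.Integer as ℤ
open ℤ using (ℤ)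
import Data.Integer.Properties as ℤₚ
import Data.Integer.Tactic.RingSolver as ℤ-Solver
import Algebra.Properties.AbelianGroup ℤₚ.+-0-abelianGroup as ℤ-Group
open import Data.List using (List; []; _∷_; concatMap; length; filter; map)
open import Data.List.Membership.Propositional using (_∈_)
open import Data.List.Membership.Propositional.Properties using (∈-concatMap⁺)
import Data.List.Properties as Listₚ
import Data.List.Relation.Unary.All as All
import Data.List.Relation.Unary.Any as Any
open Any using (here; there)
open import Data.Nat using (ℕ; zero; suc; _+_; _*_; _^_; _∸_; _/_; _!; _≤_; _<_; _≤?_; z≤n; s≤s)
open import Data.Nat.Divisibility using (_∣_; divides; ∣m+n∣m⇒∣n; ∣m∣n⇒∣m+n; m∣m*n; *-monoʳ-∣; _∣0; 1∣_)
open import Data.Nat.DivMod using (m/n*n≡m)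
import Data.Nat.Properties as ℕₚ
open import Data.Nat.Tactic.RingSolver using (solve-∀)
open import Data.Product using (∃; Σ; _×_; _,_; proj₁; proj₂)
open import Data.Sum using (_⊎_; inj₁; inj₂; [_,_]′)
open import Data.Unit using (⊤; tt)
open import Data.Vec using (Vec; []; _∷_)
import Data.Vec.Properties as Vecₚ
open import Function.Base using (_∘_; id)
open import Function.Bundles using (Inverse; _↔_; _⇔_; mk⇔)
open import Relation.Binary.PropositionalEquality
open import Relation.Nullary using (Dec; yes; no; does; ¬_; contradiction)
open import Relation.Nullary.Decidable using (_×-dec_; ¬?; does-⇔)
open import Relation.Unary using (Decidable)

-- A nonzero vector s has v·s = 1 for exactly half of all v; with s the sum of four image points,
-- this is the factor 2/N. Even weight comes from bijectivity: v·f has the weight of the linear form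
-- v. As N is divisible by 4, every Walsh coefficient N - 2·wt is then divisible by 4, and the
-- argument runs on the integers |W|/4 (`amp`), whose ceiling is N/4 = `suc r`. Integrality is
-- decisive: a nonaffine function of even weight stays at or below r, and a value r forces all
-- others down to 0 or 1. The separation bound is the triangle inequality for Hamming distance:
-- approximations with different linear parts differ by a function of weight N/2. Equality leaves
-- exactly one affine function in each pair v, v + v₀, which confines the sums of f over flats to
-- {0, e}; hence a single vector e corrects f at both exceptional points. Inequalities over the
-- naturals are kept free of subtraction by moving terms across. The coaffinity is encoded as a
-- floor quotient by 24, so divisibility by 24 is proved as well.

eqb : ∀ {n} → Pt n → Pt n → Bool
eqb x y = does (x ≟P y)

eqb-refl : ∀ {n} (x : Pt n) → eqb x x ≡ true
eqb-refl x with x ≟P x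
... | yes _ = refl
... | no x≢x with () ← x≢x refl

eqb-≢ : ∀ {n} {x y : Pt n} → x ≢ y → eqb x y ≡ false
eqb-≢ {x = x} {y} x≢y with x ≟P y
... | yes x≡y with () ← x≢y x≡y
... | no _ = refl

eqb-sound : ∀ {n} {x y : Pt n} → eqb x y ≡ true → x ≡ y
eqb-sound {x = x} {y} eq with x ≟P y
... | yes x≡y = x≡y

eqb-cong-⇔ : ∀ {m n} {x y : Pt m} {x′ y′ : Pt n} →
             (x ≡ y → x′ ≡ y′) → (x′ ≡ y′ → x ≡ y) → eqb x y ≡ eqb x′ y′
eqb-cong-⇔ {x = x} {y} {x′} {y′} to from with x ≟P y
... | yes x≡y = sym (trans (cong (λ z → eqb z y′) (to x≡y)) (eqb-refl y′))
... | no x≢y  = sym (eqb-≢ (x≢y ∘ from))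

-- Finite sums

-- Abstract in the semiring because weights and counts live in `ℕ`, while Walsh coefficients need
-- the signs of `ℤ`.
module FiniteSum {S : Set} {_+_ _*_ : S → S → S} {0# 1# : S}
                 (isCommutativeSemiring : IsCommutativeSemiring _≡_ _+_ _*_ 0# 1#) where

  open IsCommutativeSemiring isCommutativeSemiring
    using (+-assoc; +-comm; +-identityʳ; +-identityˡ; *-identityˡ; distribˡ; zeroˡ; zeroʳ; *-comm)

  ∑ : {A : Set} → List A → (A → S) → S
  ∑ []       f = 0#
  ∑ (x ∷ xs) f = f x + ∑ xs f

  private
    interchange : ∀ a b c d → (a + b) + (c + d) ≡ (a + c) + (b + d)
    interchange a b c d =
      trans (+-assoc a b (c + d))
        (trans (cong (a +_) (trans (sym (+-assoc b c d)) (trans (cong (_+ d) (+-comm b c)) (+-assoc c b d))))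
          (sym (+-assoc a c (b + d))))

  ∑-cong : ∀ {A : Set} (xs : List A) {f g : A → S} → (∀ x → f x ≡ g x) → ∑ xs f ≡ ∑ xs g
  ∑-cong []       eq = refl
  ∑-cong (x ∷ xs) eq = cong₂ _+_ (eq x) (∑-cong xs eq)

  ∑-zero : ∀ {A : Set} (xs : List A) → ∑ xs (λ _ → 0#) ≡ 0#
  ∑-zero []       = refl
  ∑-zero (x ∷ xs) = trans (+-identityˡ _) (∑-zero xs)

  ∑-distrib-+ : ∀ {A : Set} (xs : List A) (f g : A → S) → ∑ xs (λ x → f x + g x) ≡ ∑ xs f + ∑ xs g
  ∑-distrib-+ []       f g = sym (+-identityʳ 0#)
  ∑-distrib-+ (x ∷ xs) f g =
    trans (cong ((f x + g x) +_) (∑-distrib-+ xs f g)) (interchange (f x) (g x) _ _)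

  *-distribˡ-∑ : ∀ {A : Set} (xs : List A) c (f : A → S) → ∑ xs (λ x → c * f x) ≡ c * ∑ xs f
  *-distribˡ-∑ []       c f = sym (zeroʳ c)
  *-distribˡ-∑ (x ∷ xs) c f =
    trans (cong ((c * f x) +_) (*-distribˡ-∑ xs c f)) (sym (distribˡ c (f x) _))

  *-distribʳ-∑ : ∀ {A : Set} (xs : List A) c (f : A → S) → ∑ xs (λ x → f x * c) ≡ ∑ xs f * c
  *-distribʳ-∑ xs c f =
    trans (∑-cong xs (λ x → *-comm (f x) c)) (trans (*-distribˡ-∑ xs c f) (*-comm c _))

  ∑-swap : ∀ {A B : Set} (xs : List A) (ys : List B) (f : A → B → S) →
           ∑ xs (λ x → ∑ ys (f x)) ≡ ∑ ys (λ y → ∑ xs (λ x → f x y))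
  ∑-swap []       ys f = sym (∑-zero ys)
  ∑-swap (x ∷ xs) ys f =
    trans (cong (∑ ys (f x) +_) (∑-swap xs ys f)) (sym (∑-distrib-+ ys (f x) _))

  ∑ₚ : ∀ {n} → (Pt n → S) → S
  ∑ₚ {n} = ∑ (allPts n)

  ∑ₚ-suc : ∀ n (f : Pt (suc n) → S) → ∑ₚ f ≡ ∑ₚ (λ v → f (false ∷ v) + f (true ∷ v))
  ∑ₚ-suc n f = pairs (allPts n)
    where
    pairs : ∀ vs → ∑ (concatMap (λ v → (false ∷ v) ∷ (true ∷ v) ∷ []) vs) f ≡
                   ∑ vs (λ v → f (false ∷ v) + f (true ∷ v))
    pairs []       = refl
    pairs (v ∷ vs) = trans (sym (+-assoc _ _ _)) (cong ((f (false ∷ v) + f (true ∷ v)) +_) (pairs vs))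

  ⟦_⟧ : Bool → S
  ⟦ true  ⟧ = 1#
  ⟦ false ⟧ = 0#

  ∑ₚ-δ : ∀ {n} (c : Pt n) (f : Pt n → S) → ∑ₚ (λ x → ⟦ eqb x c ⟧ * f x) ≡ f c
  ∑ₚ-δ {zero}  []          f = trans (+-identityʳ _) (*-identityˡ _)
  ∑ₚ-δ {suc n} (false ∷ c) f =
    trans (∑ₚ-suc n _)
      (trans (∑-cong (allPts n) (λ v → trans (cong ((⟦ eqb v c ⟧ * f (false ∷ v)) +_) (zeroˡ _)) (+-identityʳ _)))
        (∑ₚ-δ c (λ v → f (false ∷ v))))
  ∑ₚ-δ {suc n} (true ∷ c)  f =
    trans (∑ₚ-suc n _)
      (trans (∑-cong (allPts n) (λ v → trans (cong (_+ (⟦ eqb v c ⟧ * f (true ∷ v))) (zeroˡ _)) (+-identityˡ _)))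
        (∑ₚ-δ c (λ v → f (true ∷ v))))

  ∑₄ : ∀ {n} → (Pt n → Pt n → Pt n → Pt n → S) → S
  ∑₄ φ = ∑ₚ (λ a → ∑ₚ (λ b → ∑ₚ (λ c → ∑ₚ (λ d → φ a b c d))))

  module _ (n : ℕ) where

    private
      P : List (Pt n)
      P = allPts n

    ∑₄-cong : {φ ψ : Pt n → Pt n → Pt n → Pt n → S} →
              (∀ a b c d → φ a b c d ≡ ψ a b c d) → ∑₄ φ ≡ ∑₄ ψ
    ∑₄-cong eq = ∑-cong P (λ a → ∑-cong P (λ b → ∑-cong P (λ c → ∑-cong P (eq a b c))))

    ∑₄-distrib-+ : (φ ψ : Pt n → Pt n → Pt n → Pt n → S) →
                   ∑₄ (λ a b c d → φ a b c d + ψ a b c d) ≡ ∑₄ φ + ∑₄ ψ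
    ∑₄-distrib-+ φ ψ =
      trans (∑-cong P (λ a →
        trans (∑-cong P (λ b →
          trans (∑-cong P (λ c → ∑-distrib-+ P (φ a b c) (ψ a b c)))
            (∑-distrib-+ P _ _)))
          (∑-distrib-+ P _ _)))
        (∑-distrib-+ P _ _)

    *-distribˡ-∑₄ : ∀ k (φ : Pt n → Pt n → Pt n → Pt n → S) →
                    ∑₄ (λ a b c d → k * φ a b c d) ≡ k * ∑₄ φ
    *-distribˡ-∑₄ k φ =
      trans (∑-cong P (λ a →
        trans (∑-cong P (λ b →
          trans (∑-cong P (λ c → *-distribˡ-∑ P k (φ a b c))) (*-distribˡ-∑ P k _)))
          (*-distribˡ-∑ P k _)))
        (*-distribˡ-∑ P k _)

    ∑-∑₄-swap : {A : Set} (xs : List A) (φ : A → Pt n → Pt n → Pt n → Pt n → S) →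
                ∑ xs (λ x → ∑₄ (φ x)) ≡ ∑₄ (λ a b c d → ∑ xs (λ x → φ x a b c d))
    ∑-∑₄-swap xs φ =
      trans (∑-swap xs P _) (∑-cong P (λ a →
        trans (∑-swap xs P _) (∑-cong P (λ b →
          trans (∑-swap xs P _) (∑-cong P (λ c → ∑-swap xs P _))))))

    ∑ₚ-fourth-power : (f : Pt n → S) →
      (∑ₚ f * ∑ₚ f) * (∑ₚ f * ∑ₚ f) ≡ ∑₄ (λ a b c d → (f a * f b) * (f c * f d))
    ∑ₚ-fourth-power f = sym
      (trans (∑-cong P (λ a →
        trans (∑-cong P (λ b →
          trans (∑-cong P (λ c → trans (*-distribˡ-∑ P _ _) (cong ((f a * f b) *_) (*-distribˡ-∑ P _ _))))
            (trans (*-distribˡ-∑ P _ _) (cong ((f a * f b) *_) (*-distribʳ-∑ P _ _)))))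
          (trans (*-distribʳ-∑ P _ _) (cong (_* (∑ₚ f * ∑ₚ f)) (*-distribˡ-∑ P _ _)))))
        (trans (*-distribʳ-∑ P _ _) (cong (_* (∑ₚ f * ∑ₚ f)) (*-distribʳ-∑ P _ _))))

  -- The list of points is never rearranged: `f (σ x)` is expanded as a delta sum over y, the two
  -- sums are exchanged, and adjointness leaves the single term x = `ρ y`.
  ∑ₚ-permute : ∀ {n} (σ ρ : Pt n → Pt n) → (∀ x y → eqb (σ x) y ≡ eqb x (ρ y)) →
               (f : Pt n → S) → ∑ₚ (λ x → f (σ x)) ≡ ∑ₚ f
  ∑ₚ-permute {n} σ ρ adj f =
    trans (∑-cong P (λ x → sym (∑ₚ-δ (σ x) f)))
      (trans (∑-swap P P _)
        (∑-cong P (λ y → trans (∑-cong P (λ x → cong (λ b → ⟦ b ⟧ * f y) (trans (eqb-cong-⇔ {x = y} {y = σ x} sym sym) (adj x y))))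
                           (∑ₚ-δ (ρ y) (λ _ → f y)))))
    where
    P : List (Pt n)
    P = allPts n

-- The vector space 𝔽₂ⁿ

⊕-assoc : ∀ {n} (x y z : Pt n) → (x ⊕ y) ⊕ z ≡ x ⊕ (y ⊕ z)
⊕-assoc = Vecₚ.zipWith-assoc Boolₚ.xor-assoc

⊕-comm : ∀ {n} (x y : Pt n) → x ⊕ y ≡ y ⊕ x
⊕-comm = Vecₚ.zipWith-comm Boolₚ.xor-comm

⊕-identityˡ : ∀ {n} (x : Pt n) → 𝟘 ⊕ x ≡ x
⊕-identityˡ = Vecₚ.zipWith-identityˡ Boolₚ.xor-identityˡ

⊕-identityʳ : ∀ {n} (x : Pt n) → x ⊕ 𝟘 ≡ x
⊕-identityʳ = Vecₚ.zipWith-identityʳ Boolₚ.xor-identityʳ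

⊕-self : ∀ {n} (x : Pt n) → x ⊕ x ≡ 𝟘
⊕-self []      = refl
⊕-self (b ∷ x) = cong₂ _∷_ (Boolₚ.xor-same b) (⊕-self x)

⊕-cancelʳ : ∀ {n} (x y : Pt n) → (x ⊕ y) ⊕ y ≡ x
⊕-cancelʳ x y = trans (⊕-assoc x y y) (trans (cong (x ⊕_) (⊕-self y)) (⊕-identityʳ x))

⊕-cancelˡ : ∀ {n} (x y : Pt n) → x ⊕ (x ⊕ y) ≡ y
⊕-cancelˡ x y = trans (sym (⊕-assoc x x y)) (trans (cong (_⊕ y) (⊕-self x)) (⊕-identityˡ y))

⊕≡𝟘⇒≡ : ∀ {n} {x y : Pt n} → x ⊕ y ≡ 𝟘 → x ≡ y
⊕≡𝟘⇒≡ {x = x} {y} eq = trans (sym (⊕-cancelʳ x y)) (trans (cong (_⊕ y) eq) (⊕-identityˡ y))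

⊕-swapʳ : ∀ {n} (x y z : Pt n) → (x ⊕ y) ⊕ z ≡ (x ⊕ z) ⊕ y
⊕-swapʳ x y z = trans (⊕-assoc x y z) (trans (cong (x ⊕_) (⊕-comm y z)) (sym (⊕-assoc x z y)))

⊕-interchange : ∀ {n} (a b c d : Pt n) → (a ⊕ b) ⊕ (c ⊕ d) ≡ (a ⊕ c) ⊕ (b ⊕ d)
⊕-interchange a b c d = trans (sym (⊕-assoc (a ⊕ b) c d))
  (trans (cong (_⊕ d) (⊕-swapʳ a b c)) (⊕-assoc (a ⊕ c) b d))

xor-interchange : ∀ a b c d → (a xor b) xor (c xor d) ≡ (a xor c) xor (b xor d)
xor-interchange a b c d =
  trans (Boolₚ.xor-assoc a b (c xor d))
    (trans (cong (a xor_) (trans (sym (Boolₚ.xor-assoc b c d))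
      (trans (cong (_xor d) (Boolₚ.xor-comm b c)) (Boolₚ.xor-assoc c b d))))
      (sym (Boolₚ.xor-assoc a c (b xor d))))

xor≡false⇒≡ : ∀ {a b} → a xor b ≡ false → a ≡ b
xor≡false⇒≡ {false} {false} _ = refl
xor≡false⇒≡ {true}  {true}  _ = refl

dot : ∀ {n} → Pt n → Pt n → Bool
dot []      []      = false
dot (a ∷ u) (b ∷ x) = (a ∧ b) xor dot u x

dot-comm : ∀ {n} (u x : Pt n) → dot u x ≡ dot x u
dot-comm []      []      = refl
dot-comm (a ∷ u) (b ∷ x) = cong₂ _xor_ (Boolₚ.∧-comm a b) (dot-comm u x)

dot-⊕ʳ : ∀ {n} (u x y : Pt n) → dot u (x ⊕ y) ≡ dot u x xor dot u y
dot-⊕ʳ []      []      []      = refl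
dot-⊕ʳ (a ∷ u) (b ∷ x) (c ∷ y) =
  trans (cong₂ _xor_ (Boolₚ.∧-distribˡ-xor a b c) (dot-⊕ʳ u x y))
    (xor-interchange (a ∧ b) (a ∧ c) (dot u x) (dot u y))

dot-⊕₄ : ∀ {n} (u a b c d : Pt n) →
         dot u (a ⊕ b ⊕ c ⊕ d) ≡ dot u a xor dot u b xor dot u c xor dot u d
dot-⊕₄ u a b c d = trans (dot-⊕ʳ u (a ⊕ b ⊕ c) d)
  (cong (_xor dot u d) (trans (dot-⊕ʳ u (a ⊕ b) c) (cong (_xor dot u c) (dot-⊕ʳ u a b))))

dot-⊕ˡ : ∀ {n} (u v x : Pt n) → dot (u ⊕ v) x ≡ dot u x xor dot v x
dot-⊕ˡ u v x = trans (dot-comm (u ⊕ v) x)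
  (trans (dot-⊕ʳ x u v) (cong₂ _xor_ (dot-comm x u) (dot-comm x v)))

dot-𝟘ˡ : ∀ {n} (x : Pt n) → dot 𝟘 x ≡ false
dot-𝟘ˡ []      = refl
dot-𝟘ˡ (b ∷ x) = dot-𝟘ˡ x

dot-nondegenerate : ∀ {n} (x : Pt n) → (∀ u → dot u x ≡ false) → x ≡ 𝟘
dot-nondegenerate []      _ = refl
dot-nondegenerate (b ∷ x) h = cong₂ _∷_
  (trans (sym (Boolₚ.xor-identityʳ b)) (trans (cong (b xor_) (sym (dot-𝟘ˡ x))) (h (true ∷ 𝟘))))
  (dot-nondegenerate x (λ u → h (false ∷ u)))

-- Weights of Boolean functions

open FiniteSum ℕₚ.+-*-isCommutativeSemiring

∑ₚ-1 : ∀ n → ∑ₚ {n} (λ _ → 1) ≡ 2 ^ n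
∑ₚ-1 zero    = refl
∑ₚ-1 (suc n) = trans (∑ₚ-suc n _) (trans (*-distribˡ-∑ (allPts n) 2 (λ _ → 1)) (cong (2 *_) (∑ₚ-1 n)))

∑ₚ-const : ∀ n c → ∑ₚ {n} (λ _ → c) ≡ 2 ^ n * c
∑ₚ-const n c = trans (∑-cong (allPts n) (λ _ → sym (ℕₚ.*-identityˡ c)))
  (trans (*-distribʳ-∑ (allPts n) c (λ _ → 1)) (cong (_* c) (∑ₚ-1 n)))

∈-allPts : ∀ {n} (x : Pt n) → x ∈ allPts n
∈-allPts []      = here refl
∈-allPts (b ∷ x) = ∈-concatMap⁺ _ (Any.map (pick b) (∈-allPts x))
  where
  pick : ∀ b {y} → x ≡ y → (b ∷ x) ∈ (false ∷ y) ∷ (true ∷ y) ∷ []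
  pick false refl = here refl
  pick true  refl = there (here refl)

module _ {A : Set} {f g : A → ℕ} where

  ∑-mono-≤ : ∀ xs → (∀ x → f x ≤ g x) → ∑ xs f ≤ ∑ xs g
  ∑-mono-≤ []       f≤g = z≤n
  ∑-mono-≤ (x ∷ xs) f≤g = ℕₚ.+-mono-≤ (f≤g x) (∑-mono-≤ xs f≤g)

  ∑-mono-< : ∀ {xs} → (∀ x → f x ≤ g x) → ∀ {y} → y ∈ xs → f y < g y → ∑ xs f < ∑ xs g
  ∑-mono-< {_ ∷ xs} f≤g (here refl) fy<gy = ℕₚ.+-mono-<-≤ fy<gy (∑-mono-≤ xs f≤g)
  ∑-mono-< {x ∷ _}  f≤g (there y∈)  fy<gy = ℕₚ.+-mono-≤-< (f≤g x) (∑-mono-< f≤g y∈ fy<gy)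

  ∑<∑⇒∃< : ∀ xs → ∑ xs f < ∑ xs g → ∃ λ x → f x < g x
  ∑<∑⇒∃< (x ∷ xs) lt with f x ℕₚ.<? g x
  ... | yes fx<gx = x , fx<gx
  ... | no fx≮gx  = ∑<∑⇒∃< xs (ℕₚ.+-cancelˡ-< (g x) _ _
          (ℕₚ.≤-<-trans (ℕₚ.+-monoˡ-≤ (∑ xs f) (ℕₚ.≮⇒≥ fx≮gx)) lt))

∑>0⇒∃>0 : ∀ {A : Set} {f : A → ℕ} xs → 0 < ∑ xs f → ∃ λ x → 0 < f x
∑>0⇒∃>0 {f = f} xs lt = ∑<∑⇒∃< xs (subst (_< ∑ xs f) (sym (∑-zero xs)) lt)

wt : ∀ {n} → (Pt n → Bool) → ℕ
wt g = ∑ₚ (λ x → ⟦ g x ⟧)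

wt-cong : ∀ {n} {g h : Pt n → Bool} → (∀ x → g x ≡ h x) → wt g ≡ wt h
wt-cong {n} eq = ∑-cong (allPts n) (λ x → cong ⟦_⟧ (eq x))

wt-not : ∀ {n} (g : Pt n → Bool) → wt (λ x → not (g x)) + wt g ≡ 2 ^ n
wt-not {n} g = trans (sym (∑-distrib-+ (allPts n) _ _)) (trans (∑-cong (allPts n) (λ x → one (g x))) (∑ₚ-1 n))
  where
  one : ∀ b → ⟦ not b ⟧ + ⟦ b ⟧ ≡ 1
  one false = refl
  one true  = refl

-- Inclusion-exclusion without subtraction. It gives the triangle inequality for Hamming distance
-- and, read modulo 2, the parity of the weight of a sum.
wt-xor : ∀ {n} (g h : Pt n → Bool) →
         2 * wt (λ x → g x ∧ h x) + wt (λ x → g x xor h x) ≡ wt g + wt h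
wt-xor {n} g h =
  trans (cong (_+ wt (λ x → g x xor h x)) (sym (*-distribˡ-∑ P 2 (λ x → ⟦ g x ∧ h x ⟧))))
    (trans (sym (∑-distrib-+ P _ _))
      (trans (∑-cong P (λ x → pointwise (g x) (h x))) (∑-distrib-+ P _ _)))
  where
  P : List (Pt n)
  P = allPts n
  pointwise : ∀ a b → 2 * ⟦ a ∧ b ⟧ + ⟦ a xor b ⟧ ≡ ⟦ a ⟧ + ⟦ b ⟧
  pointwise false b     = refl
  pointwise true  false = refl
  pointwise true  true  = refl

wt-triangle : ∀ {n} (g h : Pt n → Bool) → wt (λ x → g x xor h x) ≤ wt g + wt h
wt-triangle g h = ℕₚ.≤-trans (ℕₚ.m≤n+m _ _) (ℕₚ.≤-reflexive (wt-xor g h))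

wt-eqb : ∀ {n} (c : Pt n) → wt (λ x → eqb x c) ≡ 1
wt-eqb {n} c = trans (∑-cong (allPts n) (λ x → sym (ℕₚ.*-identityʳ _))) (∑ₚ-δ c (λ _ → 1))

wt≡0⇒false : ∀ {n} (g : Pt n → Bool) → wt g ≡ 0 → ∀ x → g x ≡ false
wt≡0⇒false {n} g wt≡0 x = Boolₚ.¬-not λ gx →
  ℕₚ.n≮0 (subst (_ <_) wt≡0 (∑-mono-< {f = λ _ → 0} (λ _ → z≤n) (∈-allPts x) (subst (λ b → 0 < ⟦ b ⟧) (sym gx) (s≤s z≤n))))

wt>0⇒∃true : ∀ {n} (g : Pt n → Bool) → 0 < wt g → ∃ λ x → g x ≡ true
wt>0⇒∃true {n} g lt with ∑>0⇒∃>0 (allPts n) lt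
... | x , 0<gx = x , positive (g x) 0<gx
  where
  positive : ∀ b → 0 < ⟦ b ⟧ → b ≡ true
  positive true _ = refl

wt-remove : ∀ {n} (g : Pt n → Bool) a → g a ≡ true → suc (wt (λ x → g x xor eqb x a)) ≡ wt g
wt-remove {n} g a ga = ℕₚ.+-cancelʳ-≡ 1 _ _
  (trans (ℕₚ.+-comm _ 1) (trans (trans (cong (λ k → 2 * k + wt (λ x → g x xor eqb x a)) (sym meet)) (wt-xor g (λ x → eqb x a)))
     (cong (wt g +_) (wt-eqb a))))
  where
  both : ∀ x → g x ∧ eqb x a ≡ eqb x a
  both x with x ≟P a
  ... | yes refl = trans (Boolₚ.∧-identityʳ _) ga
  ... | no _     = Boolₚ.∧-zeroʳ _
  meet : wt (λ x → g x ∧ eqb x a) ≡ 1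
  meet = trans (wt-cong both) (wt-eqb a)

wt≡2⇒pair : ∀ {n} (g : Pt n → Bool) → wt g ≡ 2 →
            ∃ λ a → ∃ λ b → a ≢ b × (∀ x → g x ≡ eqb x a xor eqb x b)
wt≡2⇒pair g wt≡2 with wt>0⇒∃true g (subst (0 <_) (sym wt≡2) (s≤s z≤n))
... | a , ga with ℕₚ.suc-injective (trans (wt-remove g a ga) wt≡2)
...   | wt≡1 with wt>0⇒∃true (λ x → g x xor eqb x a) (subst (0 <_) (sym wt≡1) (s≤s z≤n))
...     | b , gb = a , b , a≢b , λ x →
  xor≡false⇒≡ (trans (sym (Boolₚ.xor-assoc (g x) _ _)) (wt≡0⇒false _ wt≡0 x))
  where
  a≢b : a ≢ b
  a≢b refl with () ← trans (sym gb) (trans (cong₂ _xor_ ga (eqb-refl a)) refl)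
  wt≡0 : wt (λ x → (g x xor eqb x a) xor eqb x b) ≡ 0
  wt≡0 = ℕₚ.suc-injective (trans (wt-remove (λ x → g x xor eqb x a) b gb) wt≡1)

wt-pair : ∀ {n} {a b : Pt n} → a ≢ b → wt (λ x → eqb x a xor eqb x b) ≡ 2
wt-pair {n} {a} {b} a≢b =
  trans (cong (λ k → 2 * k + wt (λ x → eqb x a xor eqb x b)) (sym disjoint))
    (trans (wt-xor (λ x → eqb x a) (λ x → eqb x b)) (cong₂ _+_ (wt-eqb a) (wt-eqb b)))
  where
  never : ∀ x → eqb x a ∧ eqb x b ≡ false
  never x with x ≟P a
  ... | yes refl = eqb-≢ a≢b
  ... | no _     = refl
  disjoint : wt (λ x → eqb x a ∧ eqb x b) ≡ 0
  disjoint = trans (wt-cong never) (∑-zero (allPts n))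

-- Flipping the coordinate of u at a position where x is 1 flips `dot u x`, so a nonzero linear form
-- is balanced. The doubled form avoids halving `2 ^ n`.
wt-dot : ∀ {n} (x : Pt n) → 2 * wt (λ u → dot u x) ≡ 2 ^ n * ⟦ not (eqb x 𝟘) ⟧
wt-dot {zero}  []          = refl
wt-dot {suc n} (false ∷ x) = trans (cong (2 *_) (trans (∑ₚ-suc n _)
  (trans (∑-cong (allPts n) (λ u → cong (λ k → ⟦ dot u x ⟧ + k) (sym (ℕₚ.+-identityʳ _)))) (*-distribˡ-∑ (allPts n) 2 _))))
  (trans (cong (2 *_) (wt-dot x)) (sym (ℕₚ.*-assoc 2 (2 ^ n) _)))
wt-dot {suc n} (true ∷ x)  = trans (cong (2 *_) (trans (∑ₚ-suc n _)
  (trans (∑-cong (allPts n) (λ u → one (dot u x))) (∑ₚ-1 n)))) (sym (ℕₚ.*-identityʳ (2 ^ suc n)))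
  where
  one : ∀ b → ⟦ b ⟧ + ⟦ not b ⟧ ≡ 1
  one false = refl
  one true  = refl

-- The spectrum inequality

-- Finite search over the points supplies the case distinctions on spectra and on components
-- constructively.
∀⊎∃ : ∀ {n} {P Q : Pt n → Set} → (∀ x → P x ⊎ Q x) → (∀ x → P x) ⊎ ∃ Q
∀⊎∃ {n} p⊎q with All.decide p⊎q (allPts n)
... | inj₁ all-p = inj₁ (λ x → All.lookup all-p (∈-allPts x))
... | inj₂ any-q = inj₂ (Any.satisfied any-q)

m+k≡n⇒m<n : ∀ m k {n} → m + k ≡ n → 0 < k → m < n
m+k≡n⇒m<n m k refl 0<k = ℕₚ.m<m+n m 0<k

-- For a Walsh peak q and s = R - q with 2 ≤ s ≤ R/2; below, s = 2 + t and R = 2 s + e.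
Steep : (s q r R : ℕ) → Set
Steep s q r R = (s * s) * (R * R) + (q * q) * (q * q) + 2 * R * (r * (2 * r + 1)) < (R * R) * (R * R) + (s * s) * (q * q)

steep : ∀ t e → Steep (2 + t) (2 + t + e) (3 + 2 * t + e) (4 + 2 * t + e)
steep t e = m+k≡n⇒m<n _ _ (gap t e) (positive t e)
  where
  positive : ∀ t e →
    0 < 2 * (4 + 2 * t + e) * ((1 + t) * (3 * ((1 + t) * (1 + t)) + t + 5 * (1 + t) * e + 2 * e + 2 * (e * e)))
  positive t e = s≤s z≤n
  -- The factor `1 + t` of the difference is s - 1: the inequality closes up exactly at s = 1, the
  -- extremal peak q = r.
  gap : ∀ t e →
    ((2 + t) * (2 + t)) * ((4 + 2 * t + e) * (4 + 2 * t + e))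
      + ((2 + t + e) * (2 + t + e)) * ((2 + t + e) * (2 + t + e))
      + 2 * (4 + 2 * t + e) * ((3 + 2 * t + e) * (2 * (3 + 2 * t + e) + 1))
      + 2 * (4 + 2 * t + e) * ((1 + t) * (3 * ((1 + t) * (1 + t)) + t + 5 * (1 + t) * e + 2 * e + 2 * (e * e)))
    ≡ ((4 + 2 * t + e) * (4 + 2 * t + e)) * ((4 + 2 * t + e) * (4 + 2 * t + e))
      + ((2 + t) * (2 + t)) * ((2 + t + e) * (2 + t + e))
  gap = solve-∀

-- Here `q` stands for |W|/4 and `suc r` for N/4. What remains is a purely extremal problem: to
-- maximise the sum of fourth powers under Parseval and separation when no value reaches `suc r`.
module Spectrum {n : ℕ} (q : Pt n → ℕ) (r : ℕ) (1≤r : 1 ≤ r)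
  (parseval  : ∑ₚ (λ u → q u * q u) ≡ suc r * suc r)
  (separated : ∀ u v → u ≢ v → q u + q v ≤ suc r) where

  private
    P : List (Pt n)
    P = allPts n
    R : ℕ
    R = suc r

  X : ℕ
  X = ∑ₚ (λ u → (q u * q u) * (q u * q u))

  private
    ∑-peak : ∀ u₀ (f : Pt n → ℕ) c → ∑ₚ (λ u → f u + ⟦ eqb u u₀ ⟧ * c) ≡ ∑ₚ f + c
    ∑-peak u₀ f c = trans (∑-distrib-+ P _ _) (cong (∑ₚ f +_) (∑ₚ-δ u₀ (λ _ → c)))

    -- Away from the peak q⁴ ≤ s² q², and Parseval sums the right side. Instead of removing the peak
    -- from the sums, correction terms supported at `u₀` are added on both sides.
    off-peak-≤ : ∀ u₀ s → (∀ u → u ≢ u₀ → q u ≤ s) →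
      X + (s * s) * (q u₀ * q u₀) ≤ (s * s) * (R * R) + (q u₀ * q u₀) * (q u₀ * q u₀)
    off-peak-≤ u₀ s small = subst₂ _≤_ (∑-peak u₀ _ _)
      (trans (∑-peak u₀ _ _) (cong (_+ _) (trans (*-distribˡ-∑ P (s * s) _) (cong ((s * s) *_) parseval))))
      (∑-mono-≤ P pointwise)
      where
      pointwise : ∀ u → (q u * q u) * (q u * q u) + ⟦ eqb u u₀ ⟧ * ((s * s) * (q u₀ * q u₀)) ≤
                        (s * s) * (q u * q u) + ⟦ eqb u u₀ ⟧ * ((q u₀ * q u₀) * (q u₀ * q u₀))
      pointwise u with u ≟P u₀
      ... | yes refl = ℕₚ.≤-reflexive (swap-terms (q u * q u) (s * s))
        where
        swap-terms : ∀ a b → a * a + (b * a + 0) ≡ b * a + (a * a + 0)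
        swap-terms = solve-∀
      ... | no u≢u₀  = ℕₚ.+-monoˡ-≤ 0 (ℕₚ.*-monoˡ-≤ (q u * q u) (ℕₚ.*-mono-≤ (small u u≢u₀) (small u u≢u₀)))

  -- q takes only the values 0 and 1 away from u₀, so there q⁴ = q².
  peak : ∀ u₀ → q u₀ ≡ r → X + 2 * R * (r * (2 * r + 1)) ≡ (R * R) * (R * R)
  peak u₀ refl = ℕₚ.+-cancelʳ-≡ (r * r) _ _
    (trans (rearrange X r) (trans (cong (_+ 2 * R * (r * (2 * r + 1))) sums) (expand r)))
    where
    pointwise : ∀ u → (q u * q u) * (q u * q u) + ⟦ eqb u u₀ ⟧ * (q u₀ * q u₀) ≡
                      q u * q u + ⟦ eqb u u₀ ⟧ * ((q u₀ * q u₀) * (q u₀ * q u₀))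
    pointwise u with u ≟P u₀
    ... | yes refl = swap-terms (q u * q u)
      where
      swap-terms : ∀ a → a * a + (a + 0) ≡ a + (a * a + 0)
      swap-terms = solve-∀
    ... | no u≢u₀  = cong (_+ 0) (small (q u) (ℕₚ.+-cancelʳ-≤ (q u₀) (q u) 1 (separated u u₀ u≢u₀)))
      where
      small : ∀ k → k ≤ 1 → (k * k) * (k * k) ≡ k * k
      small zero          _ = refl
      small (suc zero)    _ = refl
      small (suc (suc k)) (s≤s ())
    sums : X + r * r ≡ R * R + (r * r) * (r * r)
    sums = trans (sym (∑-peak u₀ _ _)) (trans (∑-cong P pointwise)
             (trans (∑-peak u₀ _ _) (cong (_+ (r * r) * (r * r)) parseval)))
    rearrange : ∀ x r → x + 2 * (1 + r) * (r * (2 * r + 1)) + r * r ≡ x + r * r + 2 * (1 + r) * (r * (2 * r + 1))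
    rearrange = solve-∀
    expand : ∀ r → (1 + r) * (1 + r) + (r * r) * (r * r) + 2 * (1 + r) * (r * (2 * r + 1)) ≡
                   ((1 + r) * (1 + r)) * ((1 + r) * (1 + r)) + r * r
    expand = solve-∀

  private
    -- One factor q² is bounded by r²/4 and Parseval sums the other. With R ≤ 2r this gives X ≤ r⁴,
    -- which is 2r + 1 below the extremal value of X.
    flat-< : (∀ u → 2 * q u ≤ r) → X + 2 * R * (r * (2 * r + 1)) < (R * R) * (R * R)
    flat-< small = ℕₚ.≤-<-trans (ℕₚ.+-monoˡ-≤ _ X≤r⁴)
      (m+k≡n⇒m<n ((r * r) * (r * r) + 2 * R * (r * (2 * r + 1))) (1 + 2 * r) (expand r) (s≤s z≤n))
      where
      expand : ∀ r → (r * r) * (r * r) + 2 * (1 + r) * (r * (2 * r + 1)) + (1 + 2 * r) ≡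
                     ((1 + r) * (1 + r)) * ((1 + r) * (1 + r))
      expand = solve-∀
      quarter : ∀ a → 4 * (a * a * (a * a)) ≡ (2 * a) * (2 * a) * (a * a)
      quarter = solve-∀
      regroup : ∀ r → r * r * (2 * r * (2 * r)) ≡ 4 * (r * r * (r * r))
      regroup = solve-∀
      R≤2r : R ≤ 2 * r
      R≤2r = subst (R ≤_) (cong (r +_) (sym (ℕₚ.+-identityʳ r))) (ℕₚ.+-monoˡ-≤ r 1≤r)
      X≤r⁴ : X ≤ (r * r) * (r * r)
      X≤r⁴ = ℕₚ.*-cancelˡ-≤ 4 (begin
        4 * X                                       ≡⟨ *-distribˡ-∑ P 4 _ ⟨
        ∑ₚ (λ u → 4 * (q u * q u * (q u * q u)))    ≡⟨ ∑-cong P (λ u → quarter (q u)) ⟩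
        ∑ₚ (λ u → (2 * q u) * (2 * q u) * (q u * q u))
          ≤⟨ ∑-mono-≤ P (λ u → ℕₚ.*-monoˡ-≤ (q u * q u) (ℕₚ.*-mono-≤ (small u) (small u))) ⟩
        ∑ₚ (λ u → (r * r) * (q u * q u))            ≡⟨ *-distribˡ-∑ P (r * r) _ ⟩
        (r * r) * ∑ₚ (λ u → q u * q u)              ≡⟨ cong ((r * r) *_) parseval ⟩
        (r * r) * (R * R)                           ≤⟨ ℕₚ.*-monoʳ-≤ (r * r) (ℕₚ.*-mono-≤ R≤2r R≤2r) ⟩
        (r * r) * (2 * r * (2 * r))                 ≡⟨ regroup r ⟩
        4 * ((r * r) * (r * r))                     ∎)
        where open ℕₚ.≤-Reasoning

    steep-< : ∀ u₀ t e → r ≡ 3 + 2 * t + e → q u₀ ≡ 2 + t + e →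
              X + 2 * R * (r * (2 * r + 1)) < (R * R) * (R * R)
    steep-< u₀ t e r≡ q≡ = ℕₚ.+-cancelʳ-< ((s * s) * (q u₀ * q u₀)) _ _
      (subst (_< (R * R) * (R * R) + (s * s) * (q u₀ * q u₀)) (rearrange X _ _)
        (ℕₚ.≤-<-trans (ℕₚ.+-monoˡ-≤ (2 * R * (r * (2 * r + 1))) (off-peak-≤ u₀ s small))
          steep′))
      where
      s : ℕ
      s = 2 + t
      rearrange : ∀ a b c → a + b + c ≡ a + c + b
      rearrange = solve-∀
      split : ∀ t e → 4 + 2 * t + e ≡ 2 + t + (2 + t + e)
      split = solve-∀
      steep′ : Steep s (q u₀) r R
      steep′ = subst (λ k → Steep s k r R) (sym q≡)
        (subst₂ (Steep s (2 + t + e)) (sym r≡) (cong suc (sym r≡)) (steep t e))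
      small : ∀ u → u ≢ u₀ → q u ≤ s
      small u u≢u₀ = ℕₚ.+-cancelʳ-≤ (q u₀) (q u) s
        (ℕₚ.≤-trans (separated u u₀ u≢u₀) (ℕₚ.≤-reflexive
          (trans (cong suc r≡) (trans (split t e) (cong (s +_) (sym q≡))))))

  -- If no value exceeds r/2, the spectrum is too flat. A value above r/2 either equals r, where X
  -- is determined exactly, or leaves s = R - q ≥ 2, where the inequality is strict; so equality
  -- pins the peak to r.
  bound : (∀ u → q u ≤ r) →
    X + 2 * R * (r * (2 * r + 1)) < (R * R) * (R * R) ⊎
    (∃ λ u → q u ≡ r × X + 2 * R * (r * (2 * r + 1)) ≡ (R * R) * (R * R))
  bound q≤r with ∀⊎∃ (λ u → ℕₚ.≤-<-connex (2 * q u) r)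
  ... | inj₁ small      = inj₁ (flat-< small)
  ... | inj₂ (u₀ , r<2q) with r ∸ q u₀ in r∸q≡
  ...   | zero  = inj₂ (u₀ , q≡r , peak u₀ q≡r)
    where
    q≡r : q u₀ ≡ r
    q≡r = ℕₚ.≤-antisym (q≤r u₀) (ℕₚ.m∸n≡0⇒m≤n r∸q≡)
  ...   | suc t = inj₁ (steep-< u₀ t e (trans r≡ (trans (cong (suc t +_) q≡) (shape t e))) q≡)
    where
    r≡ : r ≡ suc t + q u₀
    r≡ = trans (sym (ℕₚ.m∸n+n≡m (q≤r u₀))) (cong (_+ q u₀) r∸q≡)
    2+t≤q : 2 + t ≤ q u₀
    2+t≤q = ℕₚ.+-cancelʳ-≤ (q u₀) (2 + t) (q u₀)
      -- From r < 2q and r = 1 + t + q follows 2 + t + q ≤ 2q.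
      (subst₂ _≤_ (cong suc r≡) (cong (q u₀ +_) (ℕₚ.+-identityʳ _)) r<2q)
    e : ℕ
    e = q u₀ ∸ (2 + t)
    q≡ : q u₀ ≡ 2 + t + e
    q≡ = sym (ℕₚ.m+[n∸m]≡n 2+t≤q)
    shape : ∀ t e → 1 + t + (2 + t + e) ≡ 3 + 2 * t + e
    shape = solve-∀

-- The Walsh transform

module ℤS = FiniteSum ℤₚ.+-*-isCommutativeSemiring

pos-∑ : {A : Set} (xs : List A) (f : A → ℕ) → ℤ.+ ∑ xs f ≡ ℤS.∑ xs (λ x → ℤ.+ f x)
pos-∑ []       f = refl
pos-∑ (x ∷ xs) f = trans (ℤₚ.pos-+ (f x) _) (cong (λ k → ℤ.+ f x ℤ.+ k) (pos-∑ xs f))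

pos-∑₄ : ∀ n (φ : Pt n → Pt n → Pt n → Pt n → ℕ) →
         ℤ.+ ∑₄ φ ≡ ℤS.∑₄ (λ a b c d → ℤ.+ φ a b c d)
pos-∑₄ n φ =
  trans (pos-∑ P _) (ℤS.∑-cong P (λ a →
    trans (pos-∑ P _) (ℤS.∑-cong P (λ b →
      trans (pos-∑ P _) (ℤS.∑-cong P (λ c → pos-∑ P _))))))
  where
  P : List (Pt n)
  P = allPts n

χ : Bool → ℤ
χ false = ℤ.+ 1
χ true  = ℤ.-[1+ 0 ]

χ-xor : ∀ a b → χ (a xor b) ≡ χ a ℤ.* χ b
χ-xor false b     = sym (ℤₚ.*-identityˡ (χ b))
χ-xor true  false = refl
χ-xor true  true  = refl

∑χ : ∀ {n} (h : Pt n → Bool) → ℤS.∑ₚ (λ x → χ (h x)) ℤ.+ ℤ.+ (2 * wt h) ≡ ℤ.+ (2 ^ n)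
∑χ {n} h = begin
  ℤS.∑ₚ (λ x → χ (h x)) ℤ.+ ℤ.+ (2 * wt h)
    ≡⟨ cong (λ k → ℤS.∑ₚ (λ x → χ (h x)) ℤ.+ k)
         (trans (cong ℤ.+_ (sym (*-distribˡ-∑ P 2 (λ x → ⟦ h x ⟧)))) (pos-∑ P _)) ⟩
  ℤS.∑ₚ (λ x → χ (h x)) ℤ.+ ℤS.∑ₚ (λ x → ℤ.+ (2 * ⟦ h x ⟧))
    ≡⟨ ℤS.∑-distrib-+ P _ _ ⟨
  ℤS.∑ₚ (λ x → χ (h x) ℤ.+ ℤ.+ (2 * ⟦ h x ⟧))
    ≡⟨ ℤS.∑-cong P (λ x → one (h x)) ⟩
  ℤS.∑ₚ {n} (λ _ → ℤ.+ 1)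
    ≡⟨ pos-∑ P (λ _ → 1) ⟨
  ℤ.+ ∑ₚ {n} (λ _ → 1)
    ≡⟨ cong ℤ.+_ (∑ₚ-1 n) ⟩
  ℤ.+ (2 ^ n) ∎
  where
  open ≡-Reasoning
  P : List (Pt n)
  P = allPts n
  one : ∀ b → χ b ℤ.+ ℤ.+ (2 * ⟦ b ⟧) ≡ ℤ.+ 1
  one false = refl
  one true  = refl

∑χ-dot : ∀ {n} (x : Pt n) → ℤS.∑ₚ (λ u → χ (dot u x)) ≡ ℤS.⟦ eqb x 𝟘 ⟧ ℤ.* ℤ.+ (2 ^ n)
∑χ-dot {n} x = solve (eqb x 𝟘)
  (trans (cong (λ k → ℤS.∑ₚ (λ u → χ (dot u x)) ℤ.+ ℤ.+ k) (sym (wt-dot x))) (∑χ (λ u → dot u x)))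
  where
  solve : ∀ b {s} → s ℤ.+ ℤ.+ (2 ^ n * ⟦ not b ⟧) ≡ ℤ.+ (2 ^ n) → s ≡ ℤS.⟦ b ⟧ ℤ.* ℤ.+ (2 ^ n)
  solve true {s} eq = trans (sym (trans (cong (λ k → s ℤ.+ ℤ.+ k) (ℕₚ.*-zeroʳ (2 ^ n))) (ℤₚ.+-identityʳ s)))
    (trans eq (sym (ℤₚ.*-identityˡ _)))
  solve false {s} eq = trans (ℤ-Group.∙-cancelʳ _ s (ℤ.+ 0) (trans (cong (λ k → s ℤ.+ ℤ.+ k) (sym (ℕₚ.*-identityʳ (2 ^ n))))
    (trans eq (sym (ℤₚ.+-identityˡ _))))) (sym (ℤₚ.*-zeroˡ (ℤ.+ (2 ^ n))))

-- Ordered quads, degenerate ones included: in a zero-sum quad with two equal points the other two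
-- agree as well, so the values of `g` cancel. Only genuine flats contribute, each with its 24
-- orderings.
bad₄ : ∀ {n} → (Pt n → Bool) → ℕ
bad₄ g = ∑₄ (λ a b c d → ⟦ eqb (a ⊕ b ⊕ c ⊕ d) 𝟘 ⟧ * ⟦ g a xor g b xor g c xor g d ⟧)

⊕≡𝟘-eqb : ∀ {n} (x y : Pt n) → eqb (x ⊕ y) 𝟘 ≡ eqb y x
⊕≡𝟘-eqb x y = eqb-cong-⇔ {x = x ⊕ y} {y = 𝟘} (λ eq → sym (⊕≡𝟘⇒≡ eq)) (λ { refl → ⊕-self x })

∑ₚ-⊕≡𝟘 : ∀ {n} (x : Pt n) → ∑ₚ (λ y → ⟦ eqb (x ⊕ y) 𝟘 ⟧) ≡ 1
∑ₚ-⊕≡𝟘 {n} x = trans (∑-cong (allPts n) (λ y → cong ⟦_⟧ (⊕≡𝟘-eqb x y))) (wt-eqb x)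

zero-sum-quads : ∀ n → ∑₄ {n} (λ a b c d → ⟦ eqb (a ⊕ b ⊕ c ⊕ d) 𝟘 ⟧) ≡ 2 ^ n * (2 ^ n * 2 ^ n)
zero-sum-quads n =
  trans (∑-cong P (λ a → trans (∑-cong P (λ b → trans (∑-cong P (λ c → ∑ₚ-⊕≡𝟘 (a ⊕ b ⊕ c))) (∑ₚ-1 n)))
                             (∑ₚ-const n (2 ^ n))))
        (∑ₚ-const n (2 ^ n * 2 ^ n))
  where
  P : List (Pt n)
  P = allPts n

module Walsh {n : ℕ} (g : Pt n → Bool) where

  private
    P : List (Pt n)
    P = allPts n
    N : ℕ
    N = 2 ^ n

  W : Pt n → ℤ
  W u = ℤS.∑ₚ (λ x → χ (g x xor dot u x))

  -- Parseval: after the square is expanded, the sum over u of the characters of a + b keeps only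
  -- the diagonal a = b.
  second-moment : ℤS.∑ₚ (λ u → W u ℤ.* W u) ≡ ℤ.+ (N * N)
  second-moment = begin
    ℤS.∑ₚ (λ u → W u ℤ.* W u)
      ≡⟨ ℤS.∑-cong P (λ u → sym (trans (ℤS.∑-cong P (λ a → ℤS.*-distribˡ-∑ P (χ (g a xor dot u a)) (λ b → χ (g b xor dot u b))))
                                     (ℤS.*-distribʳ-∑ P (W u) (λ a → χ (g a xor dot u a))))) ⟩
    ℤS.∑ₚ (λ u → ℤS.∑ₚ (λ a → ℤS.∑ₚ (λ b → χ (g a xor dot u a) ℤ.* χ (g b xor dot u b))))
      ≡⟨ trans (ℤS.∑-swap P P _) (ℤS.∑-cong P (λ a → ℤS.∑-swap P P _)) ⟩
    ℤS.∑ₚ (λ a → ℤS.∑ₚ (λ b → ℤS.∑ₚ (λ u → χ (g a xor dot u a) ℤ.* χ (g b xor dot u b))))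
      ≡⟨ ℤS.∑-cong P (λ a → trans (ℤS.∑-cong P (inner a)) (ℤS.∑ₚ-δ a _)) ⟩
    ℤS.∑ₚ (λ a → χ (g a xor g a) ℤ.* ℤ.+ N)
      ≡⟨ ℤS.∑-cong P (λ a → trans (cong (λ b → χ b ℤ.* ℤ.+ N) (Boolₚ.xor-same (g a))) (ℤₚ.*-identityˡ _)) ⟩
    ℤS.∑ₚ {n} (λ _ → ℤ.+ N)
      ≡⟨ pos-∑ P (λ _ → N) ⟨
    ℤ.+ ∑ₚ {n} (λ _ → N)
      ≡⟨ cong ℤ.+_ (∑ₚ-const n N) ⟩
    ℤ.+ (N * N) ∎
    where
    open ≡-Reasoning
    character : ∀ a b u → χ (g a xor dot u a) ℤ.* χ (g b xor dot u b) ≡ χ (g a xor g b) ℤ.* χ (dot u (a ⊕ b))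
    character a b u = trans (sym (χ-xor (g a xor dot u a) _))
      (trans (cong χ (trans (xor-interchange (g a) _ _ _) (cong (g a xor g b xor_) (sym (dot-⊕ʳ u a b)))))
        (χ-xor (g a xor g b) _))
    rotate : ∀ x y z → x ℤ.* (y ℤ.* z) ≡ y ℤ.* (x ℤ.* z)
    rotate = ℤ-Solver.solve-∀
    inner : ∀ a b → ℤS.∑ₚ (λ u → χ (g a xor dot u a) ℤ.* χ (g b xor dot u b)) ≡
                    ℤS.⟦ eqb b a ⟧ ℤ.* (χ (g a xor g b) ℤ.* ℤ.+ N)
    inner a b = trans (ℤS.∑-cong P (character a b)) (trans (ℤS.*-distribˡ-∑ P (χ (g a xor g b)) (λ u → χ (dot u (a ⊕ b))))
      (trans (cong (χ (g a xor g b) ℤ.*_) (trans (∑χ-dot (a ⊕ b)) (cong (λ e → ℤS.⟦ e ⟧ ℤ.* ℤ.+ N) (⊕≡𝟘-eqb a b))))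
        (rotate (χ (g a xor g b)) ℤS.⟦ eqb b a ⟧ (ℤ.+ N))))

  -- Orthogonality reduces the expanded fourth power to the N³ zero-sum quads. Each of them
  -- contributes N times its sign, and the sign is 1 - 2 on bad quads and 1 on the others.
  fourth-moment : ℤS.∑ₚ (λ u → (W u ℤ.* W u) ℤ.* (W u ℤ.* W u)) ℤ.+ ℤ.+ (2 * N * bad₄ g) ≡
                  ℤ.+ (N * (N * (N * N)))
  fourth-moment = begin
    ℤS.∑ₚ (λ u → (W u ℤ.* W u) ℤ.* (W u ℤ.* W u)) ℤ.+ ℤ.+ (2 * N * bad₄ g)
      ≡⟨ cong₂ ℤ._+_ (trans (ℤS.∑-cong P (λ u → ℤS.∑ₚ-fourth-power n (λ x → χ (g x xor dot u x))))
                            (trans (ℤS.∑-∑₄-swap n P (λ u a b c d → (χ (g a xor dot u a) ℤ.* χ (g b xor dot u b)) ℤ.*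
                                                                      (χ (g c xor dot u c) ℤ.* χ (g d xor dot u d))))
                              (ℤS.∑₄-cong n inner)))
                     (trans (cong ℤ.+_ (sym (*-distribˡ-∑₄ n (2 * N) _))) (pos-∑₄ n _)) ⟩
    ℤS.∑₄ {n} (λ a b c d → χ (g a xor g b xor g c xor g d) ℤ.* (ℤS.⟦ eqb (a ⊕ b ⊕ c ⊕ d) 𝟘 ⟧ ℤ.* ℤ.+ N)) ℤ.+
    ℤS.∑₄ {n} (λ a b c d → ℤ.+ (2 * N * (⟦ eqb (a ⊕ b ⊕ c ⊕ d) 𝟘 ⟧ * ⟦ g a xor g b xor g c xor g d ⟧)))
      ≡⟨ ℤS.∑₄-distrib-+ n _ _ ⟨
    ℤS.∑₄ {n} (λ a b c d → χ (g a xor g b xor g c xor g d) ℤ.* (ℤS.⟦ eqb (a ⊕ b ⊕ c ⊕ d) 𝟘 ⟧ ℤ.* ℤ.+ N) ℤ.+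
      ℤ.+ (2 * N * (⟦ eqb (a ⊕ b ⊕ c ⊕ d) 𝟘 ⟧ * ⟦ g a xor g b xor g c xor g d ⟧)))
      ≡⟨ ℤS.∑₄-cong n (λ a b c d → combine (g a xor g b xor g c xor g d) (eqb (a ⊕ b ⊕ c ⊕ d) 𝟘)) ⟩
    ℤS.∑₄ {n} (λ a b c d → ℤ.+ (N * ⟦ eqb (a ⊕ b ⊕ c ⊕ d) 𝟘 ⟧))
      ≡⟨ pos-∑₄ n (λ a b c d → N * ⟦ eqb (a ⊕ b ⊕ c ⊕ d) 𝟘 ⟧) ⟨
    ℤ.+ ∑₄ {n} (λ a b c d → N * ⟦ eqb (a ⊕ b ⊕ c ⊕ d) 𝟘 ⟧)
      ≡⟨ cong ℤ.+_ (trans (*-distribˡ-∑₄ n N _) (cong (N *_) (zero-sum-quads n))) ⟩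
    ℤ.+ (N * (N * (N * N))) ∎
    where
    open ≡-Reasoning
    character : ∀ a b c d u →
      (χ (g a xor dot u a) ℤ.* χ (g b xor dot u b)) ℤ.* (χ (g c xor dot u c) ℤ.* χ (g d xor dot u d)) ≡
      χ (g a xor g b xor g c xor g d) ℤ.* χ (dot u (a ⊕ b ⊕ c ⊕ d))
    character a b c d u = begin
      (χ (g a xor dot u a) ℤ.* χ (g b xor dot u b)) ℤ.* (χ (g c xor dot u c) ℤ.* χ (g d xor dot u d))
        ≡⟨ cong₂ ℤ._*_ (cong₂ ℤ._*_ (χ-xor (g a) _) (χ-xor (g b) _)) (cong₂ ℤ._*_ (χ-xor (g c) _) (χ-xor (g d) _)) ⟩
      ((χ (g a) ℤ.* χ (dot u a)) ℤ.* (χ (g b) ℤ.* χ (dot u b))) ℤ.*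
      ((χ (g c) ℤ.* χ (dot u c)) ℤ.* (χ (g d) ℤ.* χ (dot u d)))
        ≡⟨ regroup (χ (g a)) _ (χ (g b)) _ (χ (g c)) _ (χ (g d)) _ ⟩
      (((χ (g a) ℤ.* χ (g b)) ℤ.* χ (g c)) ℤ.* χ (g d)) ℤ.*
      (((χ (dot u a) ℤ.* χ (dot u b)) ℤ.* χ (dot u c)) ℤ.* χ (dot u d))
        ≡⟨ cong₂ ℤ._*_ (χ-xor₄ (g a) (g b) (g c) (g d)) (χ-xor₄ (dot u a) (dot u b) (dot u c) (dot u d)) ⟨
      χ (g a xor g b xor g c xor g d) ℤ.* χ (dot u a xor dot u b xor dot u c xor dot u d)
        ≡⟨ cong (λ k → χ (g a xor g b xor g c xor g d) ℤ.* χ k) (sym (dot-⊕₄ u a b c d)) ⟩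
      χ (g a xor g b xor g c xor g d) ℤ.* χ (dot u (a ⊕ b ⊕ c ⊕ d)) ∎
      where
      χ-xor₄ : ∀ p q r s → χ (p xor q xor r xor s) ≡ ((χ p ℤ.* χ q) ℤ.* χ r) ℤ.* χ s
      χ-xor₄ p q r s = trans (χ-xor (p xor q xor r) s)
        (cong (ℤ._* χ s) (trans (χ-xor (p xor q) r) (cong (ℤ._* χ r) (χ-xor p q))))
      regroup : ∀ a a′ b b′ c c′ d d′ →
        ((a ℤ.* a′) ℤ.* (b ℤ.* b′)) ℤ.* ((c ℤ.* c′) ℤ.* (d ℤ.* d′)) ≡
        (((a ℤ.* b) ℤ.* c) ℤ.* d) ℤ.* (((a′ ℤ.* b′) ℤ.* c′) ℤ.* d′)
      regroup = ℤ-Solver.solve-∀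
    inner : ∀ a b c d →
      ℤS.∑ₚ (λ u → (χ (g a xor dot u a) ℤ.* χ (g b xor dot u b)) ℤ.* (χ (g c xor dot u c) ℤ.* χ (g d xor dot u d))) ≡
      χ (g a xor g b xor g c xor g d) ℤ.* (ℤS.⟦ eqb (a ⊕ b ⊕ c ⊕ d) 𝟘 ⟧ ℤ.* ℤ.+ N)
    inner a b c d = trans (ℤS.∑-cong P (character a b c d))
      (trans (ℤS.*-distribˡ-∑ P (χ (g a xor g b xor g c xor g d)) (λ u → χ (dot u (a ⊕ b ⊕ c ⊕ d))))
      (cong (χ (g a xor g b xor g c xor g d) ℤ.*_) (∑χ-dot (a ⊕ b ⊕ c ⊕ d))))
    combine : ∀ s z → χ s ℤ.* (ℤS.⟦ z ⟧ ℤ.* ℤ.+ N) ℤ.+ ℤ.+ (2 * N * (⟦ z ⟧ * ⟦ s ⟧)) ≡ ℤ.+ (N * ⟦ z ⟧)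
    combine s     false = cong₂ ℤ._+_ (trans (cong (χ s ℤ.*_) (ℤₚ.*-zeroˡ (ℤ.+ N))) (ℤₚ.*-zeroʳ (χ s)))
                                      (cong ℤ.+_ (trans (ℕₚ.*-zeroʳ (2 * N)) (sym (ℕₚ.*-zeroʳ N))))
    combine false true  = trans (cong₂ ℤ._+_ (trans (ℤₚ.*-identityˡ _) (ℤₚ.*-identityˡ (ℤ.+ N))) (cong ℤ.+_ (ℕₚ.*-zeroʳ (2 * N))))
                                (trans (ℤₚ.+-identityʳ _) (cong ℤ.+_ (sym (ℕₚ.*-identityʳ N))))
    combine true  true  = trans (cong (λ k → χ true ℤ.* (ℤ.+ 1 ℤ.* ℤ.+ N) ℤ.+ k)
                                  (trans (cong ℤ.+_ (double N)) (ℤₚ.pos-+ N N)))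
                                (trans (reflect (ℤ.+ N)) (cong ℤ.+_ (sym (ℕₚ.*-identityʳ N))))
      where
      double : ∀ k → 2 * k * (1 * 1) ≡ k + k
      double = solve-∀
      reflect : ∀ k → ℤ.- ℤ.+ 1 ℤ.* (ℤ.+ 1 ℤ.* k) ℤ.+ (k ℤ.+ k) ≡ k
      reflect = ℤ-Solver.solve-∀

-- Boolean functions of even weight

-- Affinity as compatibility with three-term sums: no linear form or constant has to be chosen, and
-- the values over every zero-sum quad then cancel.
Aff : ∀ {n} → (Pt n → Bool) → Set
Aff g = ∀ a b c → g (a ⊕ b ⊕ c) ≡ g a xor g b xor g c

dot-⊕₃ : ∀ {n} (u a b c : Pt n) → dot u (a ⊕ b ⊕ c) ≡ dot u a xor dot u b xor dot u c
dot-⊕₃ u a b c = trans (dot-⊕ʳ u (a ⊕ b) c) (cong (_xor dot u c) (dot-⊕ʳ u a b))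

xor-affine : ∀ k a b c → k xor (a xor b xor c) ≡ (k xor a) xor (k xor b) xor (k xor c)
xor-affine false a b c = refl
xor-affine true  false false c = refl
xor-affine true  false true  c = refl
xor-affine true  true  false c = refl
xor-affine true  true  true  c = refl

Aff-dot : ∀ {n} (g : Pt n → Bool) c u → (∀ x → c xor (g x xor dot u x) ≡ false) → Aff g
Aff-dot g k u eq a b c = trans (value (a ⊕ b ⊕ c)) (trans (cong (k xor_) (dot-⊕₃ u a b c))
  (trans (xor-affine k _ _ _) (sym (cong₂ _xor_ (cong₂ _xor_ (value a) (value b)) (value c)))))
  where
  rotate : ∀ k a b → k xor (a xor b) ≡ false → a ≡ k xor b
  rotate k a b eq = sym (xor≡false⇒≡ (trans (Boolₚ.xor-assoc k b a) (trans (cong (k xor_) (Boolₚ.xor-comm b a)) eq)))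
  value : ∀ x → g x ≡ k xor dot u x
  value x = rotate k (g x) (dot u x) (eq x)

-- The fourth-moment identity with N = 4R and W² = 16 q², cleared of its common factor 8.
divide-by-8 : ∀ b R x {N} → N ≡ 4 * R → 256 * x + 2 * N * b ≡ N * (N * (N * N)) →
              b * R + 32 * x ≡ 32 * ((R * R) * (R * R))
divide-by-8 b R x refl eq = ℕₚ.*-cancelˡ-≡ (b * R + 32 * x) (32 * ((R * R) * (R * R))) 8
  (trans (left b R x) (trans eq (right R)))
  where
  left : ∀ b R x → 8 * (b * R + 32 * x) ≡ 256 * x + 2 * (4 * R) * b
  left = solve-∀
  right : ∀ R → 4 * R * (4 * R * (4 * R * (4 * R))) ≡ 8 * (32 * ((R * R) * (R * R)))
  right = solve-∀

module EvenWeight {n : ℕ} (r : ℕ) (1≤r : 1 ≤ r) (card : 2 ^ n ≡ 4 * suc r) where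

  private
    P : List (Pt n)
    P = allPts n
    R : ℕ
    R = suc r

  -- 24 · (N - 2)(N - 4)/3 for N = 4 (r + 1): each flat is counted with its 24 orderings.
  K : ℕ
  K = 64 * (r * (2 * r + 1))

  wt-dotˡ : ∀ u → wt (λ (x : Pt n) → dot u x) ≡ 2 * (R * ⟦ not (eqb u 𝟘) ⟧)
  wt-dotˡ u = ℕₚ.*-cancelˡ-≡ _ _ 2 (trans (cong (2 *_) (wt-cong (dot-comm u)))
    (trans (wt-dot u) (trans (cong (_* ⟦ not (eqb u 𝟘) ⟧) card) (regroup R _))))
    where
    regroup : ∀ a b → 4 * a * b ≡ 2 * (2 * (a * b))
    regroup = solve-∀

  wt-affine : ∀ c {u} → u ≢ 𝟘 → wt (λ (x : Pt n) → c xor dot u x) ≡ 2 * R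
  wt-affine false {u} u≢𝟘 = trans (wt-dotˡ u) (cong (2 *_)
    (trans (cong (λ b → R * ⟦ not b ⟧) (eqb-≢ u≢𝟘)) (ℕₚ.*-identityʳ R)))
  wt-affine true  {u} u≢𝟘 = ℕₚ.+-cancelʳ-≡ (2 * R) _ _
    (trans (cong (wt (λ x → not (dot u x)) +_) (sym (wt-affine false u≢𝟘)))
      (trans (wt-not (dot u)) (trans card (regroup R))))
    where
    regroup : ∀ a → 4 * a ≡ 2 * a + 2 * a
    regroup = solve-∀

  -- g agrees with x ↦ sign + u·x outside 2·half points, so its Walsh coefficient at u is ± 4·amp.
  record Approximation (g : Pt n → Bool) (u : Pt n) : Set where
    field
      sign     : Bool
      half amp : ℕ
      weight   : wt (λ x → sign xor (g x xor dot u x)) ≡ 2 * half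
      total    : half + amp ≡ R

  -- The linear form u has even weight like `g`, so their sum h has even weight too. Of h and its
  -- complement one has weight at most N/2 = 2R; this choice fixes `sign` and makes `amp` a natural
  -- number.
  approximation : ∀ g → 2 ∣ wt g → ∀ u → Approximation g u
  approximation g even u with even-sum | complement
    where
    h : Pt n → Bool
    h x = g x xor dot u x
    even-sum : 2 ∣ wt h
    even-sum = ∣m+n∣m⇒∣n (subst (2 ∣_) (sym (wt-xor g (dot u)))
      (∣m∣n⇒∣m+n even (subst (2 ∣_) (sym (wt-dotˡ u)) (m∣m*n (R * ⟦ not (eqb u 𝟘) ⟧)))))
      (m∣m*n (wt (λ x → g x ∧ dot u x)))
    complement : wt (λ x → not (h x)) + wt h ≡ 4 * R
    complement = trans (wt-not h) card
  ... | divides j wt≡j*2 | complement with j ≤? R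
  ...   | yes j≤R = record
    { sign = false ; half = j ; amp = R ∸ j
    ; weight = trans wt≡j*2 (ℕₚ.*-comm j 2) ; total = ℕₚ.m+[n∸m]≡n j≤R }
  ...   | no j≰R = record
    { sign = true ; half = R + R ∸ j ; amp = j ∸ R
    ; weight = ℕₚ.+-cancelʳ-≡ (2 * j) w (2 * (R + R ∸ j))
        (trans (cong (w +_) (trans (ℕₚ.*-comm 2 j) (sym wt≡j*2)))
          (trans complement (trans (regroup R) (trans (cong (2 *_) (sym split)) (ℕₚ.*-distribˡ-+ 2 (R + R ∸ j) j)))))
    ; total = ℕₚ.+-cancelʳ-≡ R (R + R ∸ j + (j ∸ R)) R (trans (ℕₚ.+-assoc (R + R ∸ j) (j ∸ R) R)
        (trans (cong ((R + R ∸ j) +_) (ℕₚ.m∸n+n≡m (ℕₚ.<⇒≤ (ℕₚ.≰⇒> j≰R)))) split)) }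
    where
    w : ℕ
    w = wt (λ x → not (g x xor dot u x))
    regroup : ∀ a → 4 * a ≡ 2 * (a + a)
    regroup = solve-∀
    j≤2R : j ≤ R + R
    j≤2R = ℕₚ.*-cancelˡ-≤ 2 (subst₂ _≤_ (trans wt≡j*2 (ℕₚ.*-comm j 2)) (trans complement (regroup R)) (ℕₚ.m≤n+m _ w))
    split : R + R ∸ j + j ≡ R + R
    split = ℕₚ.m∸n+n≡m j≤2R

  module Amplitudes (g : Pt n → Bool) (approximations : ∀ u → Approximation g u) where

    open Walsh g
    open module A u = Approximation (approximations u)

    private
      residue : Pt n → Pt n → Bool
      residue u x = sign u xor (g x xor dot u x)

    -- The sign turns the coefficient into N - 2·wt of the residue, that is 4R - 4·`half u` =
    -- 4·`amp u`; squaring forgets the sign.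
    W²≡16amp² : ∀ u → W u ℤ.* W u ≡ ℤ.+ (16 * (amp u * amp u))
    W²≡16amp² u = begin
      W u ℤ.* W u                                            ≡⟨ square (sign u) (W u) ⟨
      (χ (sign u) ℤ.* W u) ℤ.* (χ (sign u) ℤ.* W u)          ≡⟨ cong₂ ℤ._*_ value value ⟩
      ℤ.+ (4 * amp u) ℤ.* ℤ.+ (4 * amp u)                    ≡⟨ ℤₚ.pos-* (4 * amp u) (4 * amp u) ⟨
      ℤ.+ (4 * amp u * (4 * amp u))                          ≡⟨ cong ℤ.+_ (regroup (amp u)) ⟩
      ℤ.+ (16 * (amp u * amp u))                             ∎
      where
      open ≡-Reasoning
      regroup : ∀ a → 4 * a * (4 * a) ≡ 16 * (a * a)
      regroup = solve-∀
      plus : ∀ w → (ℤ.+ 1 ℤ.* w) ℤ.* (ℤ.+ 1 ℤ.* w) ≡ w ℤ.* w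
      plus = ℤ-Solver.solve-∀
      minus : ∀ w → (ℤ.- ℤ.+ 1 ℤ.* w) ℤ.* (ℤ.- ℤ.+ 1 ℤ.* w) ≡ w ℤ.* w
      minus = ℤ-Solver.solve-∀
      square : ∀ c w → (χ c ℤ.* w) ℤ.* (χ c ℤ.* w) ≡ w ℤ.* w
      square false = plus
      square true  = minus
      count : 4 * R ≡ 4 * amp u + 2 * wt (residue u)
      count = trans (cong (4 *_) (sym (total u))) (trans (expand (half u) (amp u)) (cong (λ k → 4 * amp u + 2 * k) (sym (weight u))))
        where
        expand : ∀ h a → 4 * (h + a) ≡ 4 * a + 2 * (2 * h)
        expand = solve-∀
      value : χ (sign u) ℤ.* W u ≡ ℤ.+ (4 * amp u)
      value = trans (sym (ℤS.*-distribˡ-∑ P (χ (sign u)) (λ x → χ (g x xor dot u x))))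
        (trans (ℤS.∑-cong P (λ x → sym (χ-xor (sign u) (g x xor dot u x))))
          (ℤ-Group.∙-cancelʳ (ℤ.+ (2 * wt (residue u))) _ _
            (trans (∑χ (residue u)) (trans (cong ℤ.+_ (trans card count)) (ℤₚ.pos-+ (4 * amp u) (2 * wt (residue u)))))))

    ∑amp² : ∑ₚ (λ u → amp u * amp u) ≡ R * R
    ∑amp² = ℕₚ.*-cancelˡ-≡ (∑ₚ (λ u → amp u * amp u)) (R * R) 16 (trans (sym (*-distribˡ-∑ P 16 (λ u → amp u * amp u))) (ℤₚ.+-injective
      (trans (pos-∑ P _) (trans (ℤS.∑-cong P (λ u → sym (W²≡16amp² u)))
        (trans second-moment (cong ℤ.+_ (trans (cong₂ _*_ card card) (regroup R))))))))
      where
      regroup : ∀ a → 4 * a * (4 * a) ≡ 16 * (a * a)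
      regroup = solve-∀

    -- In the sum of the two residues `g` cancels, and a nonconstant affine function of weight 2R
    -- remains. By the triangle inequality the residues cannot both be light.
    amp-separated : ∀ u v → u ≢ v → amp u + amp v ≤ R
    amp-separated u v u≢v = ℕₚ.+-cancelˡ-≤ R (amp u + amp v) R
      (ℕₚ.≤-trans (ℕₚ.+-monoˡ-≤ (amp u + amp v) R≤halves) (ℕₚ.≤-reflexive
        (trans (regroup (half u) (half v) (amp u) (amp v)) (cong₂ _+_ (total u) (total v)))))
      where
      regroup : ∀ a b c d → a + b + (c + d) ≡ (a + c) + (b + d)
      regroup = solve-∀
      cancel : ∀ s t h a b → (s xor (h xor a)) xor (t xor (h xor b)) ≡ (s xor t) xor (a xor b)
      cancel s t false a b = xor-interchange s a t b
      cancel s t true  a b = trans (xor-interchange s (not a) t (not b))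
        (cong ((s xor t) xor_) (Boolₚ.xor-annihilates-not a b))
      difference : wt (λ x → residue u x xor residue v x) ≡ 2 * R
      difference = trans (wt-cong (λ x → trans (cancel (sign u) (sign v) (g x) (dot u x) (dot v x))
                                           (cong (sign u xor sign v xor_) (sym (dot-⊕ˡ u v x)))))
                     (wt-affine (sign u xor sign v) (λ eq → u≢v (⊕≡𝟘⇒≡ eq)))
      R≤halves : R ≤ half u + half v
      R≤halves = ℕₚ.*-cancelˡ-≤ 2 (subst₂ _≤_ difference
        (trans (cong₂ _+_ (weight u) (weight v)) (sym (ℕₚ.*-distribˡ-+ 2 (half u) (half v))))
        (wt-triangle (residue u) (residue v)))

    open Spectrum amp r 1≤r ∑amp² amp-separated

    bad₄-spectrum : bad₄ g * R + 32 * X ≡ 32 * ((R * R) * (R * R))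
    bad₄-spectrum = divide-by-8 (bad₄ g) R X card moments
      where
      square : ∀ a → (16 * a) * (16 * a) ≡ 256 * (a * a)
      square = solve-∀
      W⁴ : ∀ u → (W u ℤ.* W u) ℤ.* (W u ℤ.* W u) ≡ ℤ.+ (256 * ((amp u * amp u) * (amp u * amp u)))
      W⁴ u = trans (cong₂ ℤ._*_ (W²≡16amp² u) (W²≡16amp² u))
        (trans (sym (ℤₚ.pos-* (16 * (amp u * amp u)) (16 * (amp u * amp u)))) (cong ℤ.+_ (square (amp u * amp u))))
      moments : 256 * X + 2 * 2 ^ n * bad₄ g ≡ 2 ^ n * (2 ^ n * (2 ^ n * 2 ^ n))
      moments = ℤₚ.+-injective (trans (ℤₚ.pos-+ (256 * X) (2 * 2 ^ n * bad₄ g)) (trans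
        (cong (ℤ._+ ℤ.+ (2 * 2 ^ n * bad₄ g)) (trans (cong ℤ.+_ (sym (*-distribˡ-∑ P 256 (λ u → (amp u * amp u) * (amp u * amp u)))))
          (trans (pos-∑ P _) (ℤS.∑-cong P (λ u → sym (W⁴ u)))))) fourth-moment))

    private
      -- Set beside `bad₄-spectrum`, this turns the comparison of `K` with `bad₄ g` into the
      -- comparison made by the spectrum inequality.
      K-spectrum : K * R + 32 * X ≡ 32 * (X + 2 * R * (r * (2 * r + 1)))
      K-spectrum = regroup (r * (2 * r + 1)) R X
        where
        regroup : ∀ ρ R x → 64 * ρ * R + 32 * x ≡ 32 * (x + 2 * R * ρ)
        regroup = solve-∀

      X≡⇒bad₄≡K : X + 2 * R * (r * (2 * r + 1)) ≡ (R * R) * (R * R) → bad₄ g ≡ K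
      X≡⇒bad₄≡K eq = ℕₚ.*-cancelʳ-≡ (bad₄ g) K R (ℕₚ.+-cancelʳ-≡ (32 * X) (bad₄ g * R) (K * R)
        (trans bad₄-spectrum (trans (cong (32 *_) (sym eq)) (sym K-spectrum))))

      X<⇒K<bad₄ : X + 2 * R * (r * (2 * r + 1)) < (R * R) * (R * R) → K < bad₄ g
      X<⇒K<bad₄ lt = ℕₚ.*-cancelʳ-< R K (bad₄ g) (ℕₚ.+-cancelʳ-< (32 * X) (K * R) (bad₄ g * R)
        (subst₂ _<_ (sym K-spectrum) (sym bad₄-spectrum) (ℕₚ.*-monoʳ-< 32 lt)))

    -- An amplitude above r must be R, so the residue vanishes and `g` is affine. Otherwise the
    -- spectrum inequality applies, and its equality case has `half u` = 1, a residue of weight 2.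
    bad₄-gap : Aff g ⊎ (K ≤ bad₄ g × (bad₄ g ≡ K → ∃ λ c → ∃ λ u → wt (λ x → c xor (g x xor dot u x)) ≡ 2))
    bad₄-gap = [ (λ amp≤r → inj₂ ([ strict , attained ]′ (bound amp≤r))) , inj₁ ∘ exact ]′
                 (∀⊎∃ (λ u → ℕₚ.≤-<-connex (amp u) r))
      where
      Gap : Set
      Gap = K ≤ bad₄ g × (bad₄ g ≡ K → ∃ λ c → ∃ λ u → wt (λ x → c xor (g x xor dot u x)) ≡ 2)
      exact : (∃ λ u → r < amp u) → Aff g
      exact (u , r<amp) = Aff-dot g (sign u) u (wt≡0⇒false (residue u) (trans (weight u) (cong (2 *_) half≡0)))
        where
        half≡0 : half u ≡ 0
        half≡0 = ℕₚ.n≤0⇒n≡0 (ℕₚ.+-cancelʳ-≤ R (half u) 0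
          (ℕₚ.≤-trans (ℕₚ.+-monoʳ-≤ (half u) r<amp) (ℕₚ.≤-reflexive (total u))))
      strict : X + 2 * R * (r * (2 * r + 1)) < (R * R) * (R * R) → Gap
      strict lt = ℕₚ.<⇒≤ (X<⇒K<bad₄ lt) , λ eq → contradiction (sym eq) (ℕₚ.<⇒≢ (X<⇒K<bad₄ lt))
      attained : (∃ λ u → amp u ≡ r × X + 2 * R * (r * (2 * r + 1)) ≡ (R * R) * (R * R)) → Gap
      attained (u , amp≡r , eq) = ℕₚ.≤-reflexive (sym (X≡⇒bad₄≡K eq)) ,
        λ _ → sign u , u , trans (weight u) (cong (2 *_) half≡1)
        where
        half≡1 : half u ≡ 1
        half≡1 = ℕₚ.+-cancelʳ-≡ r (half u) 1 (trans (cong (half u +_) (sym amp≡r)) (total u))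

    wt≡2⇒bad₄≡K : wt g ≡ 2 → bad₄ g ≡ K
    wt≡2⇒bad₄≡K wt≡2 = X≡⇒bad₄≡K (peak 𝟘 (amp≡r (sign 𝟘) (weight 𝟘)))
      where
      g+𝟘 : ∀ x → g x xor dot 𝟘 x ≡ g x
      g+𝟘 x = trans (cong (g x xor_) (dot-𝟘ˡ x)) (Boolₚ.xor-identityʳ (g x))
      amp≡r : ∀ c → wt (λ x → c xor (g x xor dot 𝟘 x)) ≡ 2 * half 𝟘 → amp 𝟘 ≡ r
      amp≡r false eq = ℕₚ.suc-injective (trans (cong (_+ amp 𝟘) (sym half≡1)) (total 𝟘))
        where
        half≡1 : half 𝟘 ≡ 1
        half≡1 = ℕₚ.*-cancelˡ-≡ (half 𝟘) 1 2 (trans (sym eq) (trans (wt-cong g+𝟘) wt≡2))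
      -- The complement of `g` is too heavy to be the chosen residue: 1 + `half 𝟘` = 2R together
      -- with `half 𝟘` ≤ R would give R ≤ 1.
      amp≡r true eq = contradiction (ℕₚ.+-cancelʳ-≤ R R 1 R+R≤1+R) (ℕₚ.<⇒≱ (s≤s 1≤r))
        where
        regroup : ∀ a → 4 * a ≡ 2 * (a + a)
        regroup = solve-∀
        1+half≡2R : 1 + half 𝟘 ≡ R + R
        1+half≡2R = ℕₚ.*-cancelˡ-≡ (1 + half 𝟘) (R + R) 2
          (trans (ℕₚ.*-distribˡ-+ 2 1 (half 𝟘)) (trans (ℕₚ.+-comm 2 (2 * half 𝟘))
            (trans (cong₂ _+_ (trans (sym eq) (wt-cong (λ x → cong not (g+𝟘 x)))) (sym wt≡2))
              (trans (wt-not g) (trans card (regroup R))))))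
        R+R≤1+R : R + R ≤ 1 + R
        R+R≤1+R = ℕₚ.≤-trans (ℕₚ.≤-reflexive (sym 1+half≡2R))
          (s≤s (ℕₚ.≤-trans (ℕₚ.m≤m+n (half 𝟘) (amp 𝟘)) (ℕₚ.≤-reflexive (total 𝟘))))

-- Affine maps

infixr 7 _·_
_·_ : ∀ {n} → Bool → Pt n → Pt n
b · e = if b then e else 𝟘

·-xor : ∀ {n} a b (e : Pt n) → (a xor b) · e ≡ a · e ⊕ b · e
·-xor false b     e = sym (⊕-identityˡ (b · e))
·-xor true  false e = sym (⊕-identityʳ e)
·-xor true  true  e = sym (⊕-self e)

dot-· : ∀ {n} (u : Pt n) b e → dot u (b · e) ≡ b ∧ dot u e
dot-· u false e = trans (dot-comm u 𝟘) (dot-𝟘ˡ u)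
dot-· u true  e = refl

AffMap : ∀ {m n} → (Pt m → Pt n) → Set
AffMap L = ∀ a b c → L (a ⊕ b ⊕ c) ≡ L a ⊕ L b ⊕ L c

AffMap-∘ : ∀ {m n o} {L : Pt n → Pt o} {M : Pt m → Pt n} → AffMap L → AffMap M → AffMap (L ∘ M)
AffMap-∘ {L = L} aL aM a b c = trans (cong L (aM a b c)) (aL _ _ _)

AffMap-translate : ∀ {n} (t : Pt n) → AffMap (_⊕ t)
AffMap-translate t x y z = sym (trans (sym (⊕-assoc (x ⊕ t ⊕ (y ⊕ t)) z t))
  (cong (λ w → w ⊕ z ⊕ t) (trans (sym (⊕-assoc (x ⊕ t) y t)) (trans (⊕-swapʳ (x ⊕ t) y t) (cong (_⊕ y) (⊕-cancelʳ x t))))))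

AffMap-inverse : ∀ {m n} {L : Pt m → Pt n} {M : Pt n → Pt m} → AffMap L →
                 (∀ y → L (M y) ≡ y) → (∀ x → M (L x) ≡ x) → AffMap M
AffMap-inverse {L = L} {M} aL LM ML a b c =
  trans (cong M (sym (trans (aL (M a) (M b) (M c)) (cong₂ _⊕_ (cong₂ _⊕_ (LM a) (LM b)) (LM c))))) (ML _)

AffMap-dot : ∀ {m n} {L : Pt m → Pt n} → (∀ v → Aff (dot v ∘ L)) → AffMap L
AffMap-dot {L = L} aff a b c = ⊕≡𝟘⇒≡ (dot-nondegenerate _ λ v →
  trans (dot-⊕ʳ v (L (a ⊕ b ⊕ c)) (L a ⊕ L b ⊕ L c))
    (trans (cong₂ _xor_ (aff v a b c) (dot-⊕₃ v (L a) (L b) (L c)))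
      (Boolₚ.xor-same (dot v (L a) xor dot v (L b) xor dot v (L c)))))

AffMap-· : ∀ {m n} {L : Pt m → Pt n} → AffMap L → ∀ x s a b →
           L (x ⊕ s · (a ⊕ b)) ≡ L x ⊕ s · (L a ⊕ L b)
AffMap-· {L = L} aL x false a b = trans (cong L (⊕-identityʳ x)) (sym (⊕-identityʳ (L x)))
AffMap-· {L = L} aL x true  a b =
  trans (cong L (sym (⊕-assoc x a b))) (trans (aL x a b) (⊕-assoc (L x) (L a) (L b)))

linear⇒matrix : ∀ {m n} (ℓ : Pt m → Pt n) → (∀ x y → ℓ (x ⊕ y) ≡ ℓ x ⊕ ℓ y) →
                ∃ λ A → ∀ x → vecMat x A ≡ ℓ x
linear⇒matrix {zero}  ℓ add = [] , λ { [] → sym (trans (add [] []) (⊕-self (ℓ []))) }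
linear⇒matrix {suc m} ℓ add with linear⇒matrix (ℓ ∘ (false ∷_)) (λ x y → add (false ∷ x) (false ∷ y))
... | A , correct = ℓ (true ∷ 𝟘) ∷ A , λ
  { (false ∷ x) → correct x
  ; (true ∷ x)  → trans (cong (ℓ (true ∷ 𝟘) ⊕_) (correct x))
                    (trans (sym (add (true ∷ 𝟘) (false ∷ x))) (cong (ℓ ∘ (true ∷_)) (⊕-identityˡ x))) }

AffMap⇒linear : ∀ {m n} {L : Pt m → Pt n} → AffMap L → ∀ x y → L (x ⊕ y) ⊕ L 𝟘 ≡ (L x ⊕ L 𝟘) ⊕ (L y ⊕ L 𝟘)
AffMap⇒linear {L = L} aL x y = begin
  L (x ⊕ y) ⊕ L 𝟘              ≡⟨ cong (λ z → L z ⊕ L 𝟘) (sym (⊕-identityʳ (x ⊕ y))) ⟩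
  L (x ⊕ y ⊕ 𝟘) ⊕ L 𝟘          ≡⟨ cong (_⊕ L 𝟘) (aL x y 𝟘) ⟩
  L x ⊕ L y ⊕ L 𝟘 ⊕ L 𝟘        ≡⟨ cong (_⊕ L 𝟘) (⊕-swapʳ (L x) (L y) (L 𝟘)) ⟩
  L x ⊕ L 𝟘 ⊕ L y ⊕ L 𝟘        ≡⟨ ⊕-assoc (L x ⊕ L 𝟘) (L y) (L 𝟘) ⟩
  (L x ⊕ L 𝟘) ⊕ (L y ⊕ L 𝟘)    ∎
  where open ≡-Reasoning

-- The inverse matrix is read off the inverse map: removing the translation from `L` leaves an
-- additive bijection, whose inverse is additive as well.
AffMap⇒IsAffine : ∀ {n} (L M : Pt n → Pt n) → AffMap L →
                  (∀ y → L (M y) ≡ y) → (∀ x → M (L x) ≡ x) → IsAffine L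
AffMap⇒IsAffine L M aL LM ML =
  proj₁ forward , L 𝟘 , (proj₁ backward , left , right) ,
  λ x → trans (sym (⊕-cancelʳ (L x) (L 𝟘))) (cong (_⊕ L 𝟘) (sym (proj₂ forward x)))
  where
  ℓ m : Pt _ → Pt _
  ℓ x = L x ⊕ L 𝟘
  m y = M (y ⊕ L 𝟘)
  mℓ : ∀ x → m (ℓ x) ≡ x
  mℓ x = trans (cong M (⊕-cancelʳ (L x) (L 𝟘))) (ML x)
  ℓm : ∀ y → ℓ (m y) ≡ y
  ℓm y = trans (cong (_⊕ L 𝟘) (LM (y ⊕ L 𝟘))) (⊕-cancelʳ y (L 𝟘))
  ℓ-add : ∀ x y → ℓ (x ⊕ y) ≡ ℓ x ⊕ ℓ y
  ℓ-add = AffMap⇒linear aL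
  m-add : ∀ x y → m (x ⊕ y) ≡ m x ⊕ m y
  m-add x y = trans (cong m (sym (trans (ℓ-add (m x) (m y)) (cong₂ _⊕_ (ℓm x) (ℓm y))))) (mℓ (m x ⊕ m y))
  forward : ∃ λ A → ∀ x → vecMat x A ≡ ℓ x
  forward = linear⇒matrix ℓ ℓ-add
  backward : ∃ λ B → ∀ y → vecMat y B ≡ m y
  backward = linear⇒matrix m m-add
  left : ∀ x → vecMat (vecMat x (proj₁ forward)) (proj₁ backward) ≡ x
  left x = trans (proj₂ backward _) (trans (cong m (proj₂ forward x)) (mℓ x))
  right : ∀ y → vecMat (vecMat y (proj₁ backward)) (proj₁ forward) ≡ y
  right y = trans (proj₂ forward _) (trans (cong ℓ (proj₂ backward y)) (ℓm y))

vecMat-⊕ : ∀ {m n} (x y : Pt m) (A : Vec (Pt n) m) → vecMat (x ⊕ y) A ≡ vecMat x A ⊕ vecMat y A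
vecMat-⊕ []          []          []      = sym (⊕-identityˡ 𝟘)
vecMat-⊕ (false ∷ x) (false ∷ y) (r ∷ A) = vecMat-⊕ x y A
vecMat-⊕ (true ∷ x)  (false ∷ y) (r ∷ A) = trans (cong (r ⊕_) (vecMat-⊕ x y A)) (sym (⊕-assoc r _ _))
vecMat-⊕ (false ∷ x) (true ∷ y)  (r ∷ A) = trans (cong (r ⊕_) (trans (vecMat-⊕ x y A) (⊕-comm _ _)))
  (trans (sym (⊕-assoc r _ _)) (⊕-comm _ _))
vecMat-⊕ (true ∷ x)  (true ∷ y)  (r ∷ A) = trans (vecMat-⊕ x y A)
  (trans (sym (⊕-cancelˡ r (vecMat x A ⊕ vecMat y A)))
    (trans (⊕-comm r _) (trans (cong (_⊕ r) (sym (⊕-assoc r _ _)))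
      (trans (⊕-assoc (r ⊕ vecMat x A) (vecMat y A) r) (cong ((r ⊕ vecMat x A) ⊕_) (⊕-comm _ r))))))

module Affine {n : ℕ} {α : Pt n → Pt n} (affine : IsAffine α) where

  private
    A : Mat n
    A = proj₁ affine
    b : Pt n
    b = proj₁ (proj₂ affine)
    B : Mat n
    B = proj₁ (proj₁ (proj₂ (proj₂ affine)))
    AB : ∀ x → vecMat (vecMat x A) B ≡ x
    AB = proj₁ (proj₂ (proj₁ (proj₂ (proj₂ affine))))
    BA : ∀ x → vecMat (vecMat x B) A ≡ x
    BA = proj₂ (proj₂ (proj₁ (proj₂ (proj₂ affine))))
    α≡ : ∀ x → α x ≡ vecMat x A ⊕ b
    α≡ = proj₂ (proj₂ (proj₂ affine))

  affMap : AffMap α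
  affMap x y z = begin
    α (x ⊕ y ⊕ z)                          ≡⟨ α≡ (x ⊕ y ⊕ z) ⟩
    vecMat (x ⊕ y ⊕ z) A ⊕ b               ≡⟨ cong (_⊕ b) (trans (vecMat-⊕ (x ⊕ y) z A) (cong (_⊕ vecMat z A) (vecMat-⊕ x y A))) ⟩
    X ⊕ Y ⊕ Z ⊕ b                          ≡⟨ AffMap-translate b X Y Z ⟩
    (X ⊕ b) ⊕ (Y ⊕ b) ⊕ (Z ⊕ b)            ≡⟨ cong₂ _⊕_ (cong₂ _⊕_ (α≡ x) (α≡ y)) (α≡ z) ⟨
    α x ⊕ α y ⊕ α z                        ∎
    where
    open ≡-Reasoning
    X Y Z : Pt n
    X = vecMat x A
    Y = vecMat y A
    Z = vecMat z A

  inv : Pt n → Pt n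
  inv y = vecMat (y ⊕ b) B

  inverseˡ : ∀ x → inv (α x) ≡ x
  inverseˡ x = trans (cong (λ y → vecMat (y ⊕ b) B) (α≡ x))
    (trans (cong (λ y → vecMat y B) (⊕-cancelʳ (vecMat x A) b)) (AB x))

  inverseʳ : ∀ y → α (inv y) ≡ y
  inverseʳ y = trans (α≡ (inv y)) (trans (cong (_⊕ b) (BA (y ⊕ b))) (⊕-cancelʳ y b))

-- When the heads differ, only one vector sees the head coordinate of w. The tail of w is chosen for
-- the other vector, and the head then corrects the first product to 1.
common-dual : ∀ {n} (s t : Pt n) → s ≢ 𝟘 → t ≢ 𝟘 → ∃ λ w → dot w s ≡ true × dot w t ≡ true
common-dual []          []          s≢𝟘 _   = contradiction refl s≢𝟘
common-dual (true ∷ s)  (true ∷ t)  _   _   = true ∷ 𝟘 , cong not (dot-𝟘ˡ s) , cong not (dot-𝟘ˡ t)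
common-dual (false ∷ s) (false ∷ t) s≢𝟘 t≢𝟘 with common-dual s t (s≢𝟘 ∘ cong (false ∷_)) (t≢𝟘 ∘ cong (false ∷_))
... | w , ws , wt = false ∷ w , ws , wt
common-dual (true ∷ s)  (false ∷ t) _   t≢𝟘 with common-dual t t (t≢𝟘 ∘ cong (false ∷_)) (t≢𝟘 ∘ cong (false ∷_))
... | w , wt , _ = not (dot w s) ∷ w , trans (cong (_xor dot w s) (Boolₚ.∧-identityʳ (not (dot w s)))) (Boolₚ.xor-inverseˡ (dot w s)) ,
                   trans (cong (_xor dot w t) (Boolₚ.∧-zeroʳ (not (dot w s)))) wt
common-dual (false ∷ s) (true ∷ t)  s≢𝟘 _   with common-dual s s (s≢𝟘 ∘ cong (false ∷_)) (s≢𝟘 ∘ cong (false ∷_))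
... | w , ws , _ = not (dot w t) ∷ w , trans (cong (_xor dot w s) (Boolₚ.∧-zeroʳ (not (dot w t)))) ws ,
                   trans (cong (_xor dot w t) (Boolₚ.∧-identityʳ (not (dot w t)))) (Boolₚ.xor-inverseˡ (dot w t))

record AffineBijection (n : ℕ) : Set where
  field
    to from  : Pt n → Pt n
    to-aff   : AffMap to
    to-from  : ∀ y → to (from y) ≡ y
    from-to  : ∀ x → from (to x) ≡ x

-- If w·(a + b) = w·(a′ + b′) = 1 and e = a + b + a′ + b′, then x ↦ x + (w·x) e is an involution
-- exchanging a + b and a′ + b′.
two-transitive : ∀ {n} {a b a′ b′ : Pt n} → a ≢ b → a′ ≢ b′ →
                 Σ (AffineBijection n) λ γ → let open AffineBijection γ in to a ≡ a′ × to b ≡ b′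
two-transitive {n} {a} {b} {a′} {b′} a≢b a′≢b′
  with common-dual (a ⊕ b) (a′ ⊕ b′) (a≢b ∘ ⊕≡𝟘⇒≡) (a′≢b′ ∘ ⊕≡𝟘⇒≡)
... | w , ws , wt = record
  { to = λ x → ℓ (x ⊕ a) ⊕ a′
  ; from = λ y → ℓ (y ⊕ a′) ⊕ a
  ; to-aff = AffMap-∘ {L = _⊕ a′} (AffMap-translate a′) (AffMap-∘ {L = ℓ} ℓ-aff (AffMap-translate a))
  ; to-from = λ y → roundtrip y a′ a
  ; from-to = λ x → roundtrip x a a′
  } , to-a , to-b
  where
  e : Pt n
  e = (a ⊕ b) ⊕ (a′ ⊕ b′)
  -- Since w·e = 1 + 1 = 0, `ℓ` preserves w·x, and applying it twice adds the same multiple of `e`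
  -- twice.
  we : dot w e ≡ false
  we = trans (dot-⊕ʳ w (a ⊕ b) (a′ ⊕ b′)) (cong₂ _xor_ ws wt)
  ℓ : Pt n → Pt n
  ℓ x = x ⊕ dot w x · e
  ℓ-aff : AffMap ℓ
  ℓ-aff x y z = trans (cong (λ p → (x ⊕ y ⊕ z) ⊕ p · e) (dot-⊕₃ w x y z))
    (trans (cong ((x ⊕ y ⊕ z) ⊕_) (trans (·-xor (dot w x xor dot w y) (dot w z) e) (cong (_⊕ dot w z · e) (·-xor (dot w x) (dot w y) e))))
      (trans (⊕-interchange (x ⊕ y) z _ _) (cong (_⊕ (z ⊕ dot w z · e)) (⊕-interchange x y _ _))))
  ℓ-involutive : ∀ x → ℓ (ℓ x) ≡ x
  ℓ-involutive x = trans (cong (λ p → ℓ x ⊕ p · e) same) (⊕-cancelʳ x (dot w x · e))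
    where
    same : dot w (ℓ x) ≡ dot w x
    same = trans (dot-⊕ʳ w x (dot w x · e)) (trans (cong (dot w x xor_) (trans (dot-· w (dot w x) e)
      (trans (cong (dot w x ∧_) we) (Boolₚ.∧-zeroʳ (dot w x))))) (Boolₚ.xor-identityʳ (dot w x)))
  roundtrip : ∀ x p q → ℓ ((ℓ (x ⊕ p) ⊕ q) ⊕ q) ⊕ p ≡ x
  roundtrip x p q = trans (cong (λ y → ℓ y ⊕ p) (⊕-cancelʳ (ℓ (x ⊕ p)) q))
    (trans (cong (_⊕ p) (ℓ-involutive (x ⊕ p))) (⊕-cancelʳ x p))
  to-a : ℓ (a ⊕ a) ⊕ a′ ≡ a′
  to-a = trans (cong (λ y → ℓ y ⊕ a′) (⊕-self a))
    (trans (cong (_⊕ a′) (trans (⊕-identityˡ _) (cong (_· e) (dot-𝟘ʳ)))) (⊕-identityˡ a′))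
    where
    dot-𝟘ʳ : dot w 𝟘 ≡ false
    dot-𝟘ʳ = trans (dot-comm w 𝟘) (dot-𝟘ˡ w)
  to-b : ℓ (b ⊕ a) ⊕ a′ ≡ b′
  to-b = trans (cong (λ y → ℓ y ⊕ a′) (⊕-comm b a))
    (trans (cong (λ p → ((a ⊕ b) ⊕ p · e) ⊕ a′) ws)
      (trans (cong (_⊕ a′) (⊕-cancelˡ (a ⊕ b) (a′ ⊕ b′))) (trans (⊕-comm _ a′) (⊕-cancelˡ a′ b′))))

-- The identity plus an indicator times a fixed vector: in this form an affine map can be carried
-- through the transposition.
swap-⊕ : ∀ {n} {a b : Pt n} → a ≢ b → ∀ x → swap a b x ≡ x ⊕ (eqb x a xor eqb x b) · (a ⊕ b)
swap-⊕ {a = a} {b} a≢b x with x ≟P a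
... | yes refl = sym (trans (cong (λ p → x ⊕ not p · (x ⊕ b)) (eqb-≢ a≢b)) (⊕-cancelˡ x b))
... | no _ with x ≟P b
...   | yes refl = sym (trans (cong (x ⊕_) (⊕-comm a x)) (⊕-cancelˡ x a))
...   | no _     = sym (⊕-identityʳ x)

eqb-injective : ∀ {m n} {γ : Pt m → Pt n} → (∀ {x y} → γ x ≡ γ y → x ≡ y) → ∀ x y → eqb (γ x) (γ y) ≡ eqb x y
eqb-injective {γ = γ} inj x y = eqb-cong-⇔ {x = γ x} {y = γ y} inj (cong γ)

swap-conjugate : ∀ {n} {γ : Pt n → Pt n} → AffMap γ → (∀ {x y} → γ x ≡ γ y → x ≡ y) →
                 ∀ {a b} → a ≢ b → ∀ x → γ (swap a b x) ≡ swap (γ a) (γ b) (γ x)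
swap-conjugate {γ = γ} aff inj {a} {b} a≢b x =
  trans (cong γ (swap-⊕ a≢b x)) (trans (AffMap-· aff x (eqb x a xor eqb x b) a b)
    (trans (cong (λ p → γ x ⊕ p · (γ a ⊕ γ b)) (sym (cong₂ _xor_ (eqb-injective inj x a) (eqb-injective inj x b))))
      (sym (swap-⊕ (a≢b ∘ inj) (γ x)))))

-- Symmetric sums

module _ {A : Set} where

  ∑ᵛ : ∀ k → List A → (Vec A k → ℕ) → ℕ
  ∑ᵛ zero    xs φ = φ []
  ∑ᵛ (suc k) xs φ = ∑ xs (λ a → ∑ᵛ k xs (φ ∘ (a ∷_)))

  -- Symmetry and vanishing are required for the first two entries under every prefix, hence for all
  -- adjacent pairs; together they make any repeated entry give 0.
  Alternating : ∀ k → (Vec A k → ℕ) → Set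
  Alternating zero          φ = ⊤
  Alternating (suc zero)    φ = ⊤
  Alternating (suc (suc k)) φ =
    (∀ a → Alternating (suc k) (φ ∘ (a ∷_))) ×
    (∀ a b v → φ (a ∷ b ∷ v) ≡ φ (b ∷ a ∷ v)) ×
    (∀ a v → φ (a ∷ a ∷ v) ≡ 0)

  ∑ᵛ-cong : ∀ k xs {φ ψ : Vec A k → ℕ} → (∀ v → φ v ≡ ψ v) → ∑ᵛ k xs φ ≡ ∑ᵛ k xs ψ
  ∑ᵛ-cong zero    xs eq = eq []
  ∑ᵛ-cong (suc k) xs eq = ∑-cong xs (λ a → ∑ᵛ-cong k xs (eq ∘ (a ∷_)))

  ∑ᵛ-zero : ∀ k xs {φ : Vec A k → ℕ} → (∀ v → φ v ≡ 0) → ∑ᵛ k xs φ ≡ 0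
  ∑ᵛ-zero zero    xs eq = eq []
  ∑ᵛ-zero (suc k) xs eq = trans (∑-cong xs (λ a → ∑ᵛ-zero k xs (eq ∘ (a ∷_)))) (∑-zero xs)

  -- Tuples using the new list entry twice contribute 0. Those using it once contribute equally for
  -- each of its `suc k` positions.
  ∑ᵛ-∷ : ∀ k x xs (φ : Vec A (suc k) → ℕ) → Alternating (suc k) φ →
         ∑ᵛ (suc k) (x ∷ xs) φ ≡ ∑ᵛ (suc k) xs φ + suc k * ∑ᵛ k xs (φ ∘ (x ∷_))
  ∑ᵛ-∷ zero    x xs φ _ = trans (ℕₚ.+-comm (φ (x ∷ [])) _) (cong (∑ᵛ 1 xs φ +_) (sym (ℕₚ.+-identityʳ _)))
  ∑ᵛ-∷ (suc k) x xs φ (alt , symm , diag) = begin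
    ∑ᵛ (suc k) (x ∷ xs) (φ ∘ (x ∷_)) + ∑ xs (λ a → ∑ᵛ (suc k) (x ∷ xs) (φ ∘ (a ∷_)))
      ≡⟨ cong₂ _+_ (trans (∑ᵛ-∷ k x xs (φ ∘ (x ∷_)) (alt x))
                     (trans (cong (λ z → S + suc k * z) (∑ᵛ-zero k xs (diag x)))
                       (trans (cong (S +_) (ℕₚ.*-zeroʳ (suc k))) (ℕₚ.+-identityʳ S))))
                   (trans (∑-cong xs (λ a → trans (∑ᵛ-∷ k x xs (φ ∘ (a ∷_)) (alt a))
                                              (cong (λ z → ∑ᵛ (suc k) xs (φ ∘ (a ∷_)) + suc k * z)
                                                (∑ᵛ-cong k xs (λ v → symm a x v)))))
                     (trans (∑-distrib-+ xs _ _) (cong (T +_) (*-distribˡ-∑ xs (suc k) _)))) ⟩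
    S + (T + suc k * S)
      ≡⟨ regroup S T k ⟩
    T + (2 + k) * S ∎
    where
    open ≡-Reasoning
    S T : ℕ
    S = ∑ᵛ (suc k) xs (φ ∘ (x ∷_))
    T = ∑ᵛ (suc (suc k)) xs φ
    regroup : ∀ s t k → s + (t + (1 + k) * s) ≡ t + (2 + k) * s
    regroup = solve-∀

  -- For k = 4 this makes the division by 24 exact. Tuples avoiding the new entry are covered by
  -- induction, and the others carry `suc k` times a multiple of `k !`.
  !∣∑ᵛ : ∀ k xs (φ : Vec A k → ℕ) → Alternating k φ → k ! ∣ ∑ᵛ k xs φ
  !∣∑ᵛ zero    xs       φ alt = 1∣ _
  !∣∑ᵛ (suc k) []       φ alt = _ ∣0
  !∣∑ᵛ (suc k) (x ∷ xs) φ alt = subst (suc k ! ∣_) (sym (∑ᵛ-∷ k x xs φ alt))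
    (∣m∣n⇒∣m+n (!∣∑ᵛ (suc k) xs φ alt) (*-monoʳ-∣ (suc k) (!∣∑ᵛ k xs (φ ∘ (x ∷_)) (head-alternating k φ alt))))
    where
    head-alternating : ∀ k (φ : Vec A (suc k) → ℕ) → Alternating (suc k) φ → Alternating k (φ ∘ (x ∷_))
    head-alternating zero    φ _         = tt
    head-alternating (suc k) φ (alt , _) = alt x

-- Counting bad flats

module _ {A B : Set} {Q : B → Set} (Q? : Decidable Q) where

  length-filter-concatMap : ∀ (g : A → List B) xs →
    length (filter Q? (concatMap g xs)) ≡ ∑ xs (λ x → length (filter Q? (g x)))
  length-filter-concatMap g []       = refl
  length-filter-concatMap g (x ∷ xs) =
    trans (cong length (Listₚ.filter-++ Q? (g x) (concatMap g xs)))
      (trans (Listₚ.length-++ (filter Q? (g x)))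
        (cong (length (filter Q? (g x)) +_) (length-filter-concatMap g xs)))

  length-filter-map : ∀ (h : A → B) xs → length (filter Q? (map h xs)) ≡ ∑ xs (λ x → ⟦ does (Q? (h x)) ⟧)
  length-filter-map h []       = refl
  length-filter-map h (x ∷ xs) with does (Q? (h x))
  ... | true  = cong suc (length-filter-map h xs)
  ... | false = length-filter-map h xs

module _ {n : ℕ} where

  ⊕-swap₁₂ : ∀ (a b c d : Pt n) → a ⊕ b ⊕ c ⊕ d ≡ b ⊕ a ⊕ c ⊕ d
  ⊕-swap₁₂ a b c d = cong (λ z → z ⊕ c ⊕ d) (⊕-comm a b)

  ⊕-swap₂₃ : ∀ (a b c d : Pt n) → a ⊕ b ⊕ c ⊕ d ≡ a ⊕ c ⊕ b ⊕ d
  ⊕-swap₂₃ a b c d = cong (_⊕ d) (⊕-swapʳ a b c)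

  ⊕-swap₃₄ : ∀ (a b c d : Pt n) → a ⊕ b ⊕ c ⊕ d ≡ a ⊕ b ⊕ d ⊕ c
  ⊕-swap₃₄ a b c d = ⊕-swapʳ (a ⊕ b) c d

  ⊕₄-pairˡ : ∀ (a c d : Pt n) → a ⊕ a ⊕ c ⊕ d ≡ c ⊕ d
  ⊕₄-pairˡ a c d = cong (_⊕ d) (trans (cong (_⊕ c) (⊕-self a)) (⊕-identityˡ c))

  module _ (f : Pt n → Pt n) where

    -- Distinctness is left to the arithmetic: a zero-sum quad with a repeated point has a zero-sum
    -- image and contributes 0.
    badMap : Pt n → Pt n → Pt n → Pt n → ℕ
    badMap a b c d = ⟦ eqb (a ⊕ b ⊕ c ⊕ d) 𝟘 ⟧ * ⟦ not (eqb (f a ⊕ f b ⊕ f c ⊕ f d) 𝟘) ⟧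

    badCount : ℕ
    badCount = ∑₄ badMap

    -- Holds whenever two of the points coincide. Adjacent swaps carry the case of equal first
    -- points to the other five, one for each disequality in `Distinct4`.
    ZeroSum : Pt n → Pt n → Pt n → Pt n → Set
    ZeroSum a b c d = a ⊕ b ⊕ c ⊕ d ≡ 𝟘 → f a ⊕ f b ⊕ f c ⊕ f d ≡ 𝟘

    zeroSum₁₂ : ∀ {a b} → a ≡ b → ∀ c d → ZeroSum a b c d
    zeroSum₁₂ {a} refl c d eq with ⊕≡𝟘⇒≡ (trans (sym (⊕₄-pairˡ a c d)) eq)
    ... | refl = trans (⊕₄-pairˡ (f a) (f c) (f c)) (⊕-self (f c))

    zeroSum-swap₁₂ : ∀ a b c d → ZeroSum a b c d → ZeroSum b a c d
    zeroSum-swap₁₂ a b c d zs eq = trans (⊕-swap₁₂ (f b) (f a) (f c) (f d)) (zs (trans (⊕-swap₁₂ a b c d) eq))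

    zeroSum-swap₂₃ : ∀ a b c d → ZeroSum a b c d → ZeroSum a c b d
    zeroSum-swap₂₃ a b c d zs eq = trans (⊕-swap₂₃ (f a) (f c) (f b) (f d)) (zs (trans (⊕-swap₂₃ a b c d) eq))

    zeroSum-swap₃₄ : ∀ a b c d → ZeroSum a b c d → ZeroSum a b d c
    zeroSum-swap₃₄ a b c d zs eq = trans (⊕-swap₃₄ (f a) (f b) (f d) (f c)) (zs (trans (⊕-swap₃₄ a b c d) eq))

    zeroSum₁₃ : ∀ {a c} → a ≡ c → ∀ b d → ZeroSum a b c d
    zeroSum₁₃ {a} {c} eq b d = zeroSum-swap₂₃ a c b d (zeroSum₁₂ eq b d)

    zeroSum₁₄ : ∀ {a d} → a ≡ d → ∀ b c → ZeroSum a b c d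
    zeroSum₁₄ {a} {d} eq b c = zeroSum-swap₃₄ a b d c (zeroSum₁₃ eq b c)

    zeroSum₂₃ : ∀ {b c} → b ≡ c → ∀ a d → ZeroSum a b c d
    zeroSum₂₃ {b} {c} eq a d = zeroSum-swap₁₂ b a c d (zeroSum₁₃ eq a d)

    zeroSum₂₄ : ∀ {b d} → b ≡ d → ∀ a c → ZeroSum a b c d
    zeroSum₂₄ {b} {d} eq a c = zeroSum-swap₃₄ a b d c (zeroSum₂₃ eq a c)

    zeroSum₃₄ : ∀ {c d} → c ≡ d → ∀ a b → ZeroSum a b c d
    zeroSum₃₄ {c} {d} eq a b = zeroSum-swap₂₃ a c b d (zeroSum₂₄ eq a b)

    zeroSum⇒badMap≡0 : ∀ a b c d → ZeroSum a b c d → badMap a b c d ≡ 0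
    zeroSum⇒badMap≡0 a b c d zs with (a ⊕ b ⊕ c ⊕ d) ≟P 𝟘
    ... | no _   = refl
    ... | yes eq = trans (ℕₚ.+-identityʳ _) (trans (cong (λ z → ⟦ not (eqb z 𝟘) ⟧) (zs eq)) (cong (⟦_⟧ ∘ not) (eqb-refl {n} 𝟘)))

    badMap-cong : ∀ {a b c d a′ b′ c′ d′} → a ⊕ b ⊕ c ⊕ d ≡ a′ ⊕ b′ ⊕ c′ ⊕ d′ →
                  f a ⊕ f b ⊕ f c ⊕ f d ≡ f a′ ⊕ f b′ ⊕ f c′ ⊕ f d′ → badMap a b c d ≡ badMap a′ b′ c′ d′
    badMap-cong eq eq′ = cong₂ (λ s t → ⟦ eqb s 𝟘 ⟧ * ⟦ not (eqb t 𝟘) ⟧) eq eq′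

    24∣badCount : 24 ∣ badCount
    24∣badCount = !∣∑ᵛ 4 (allPts n) φ
      ( (λ a → (λ b → (λ c → tt) ,
                 (λ { c d [] → badMap-cong (⊕-swap₃₄ a b c d) (⊕-swap₃₄ (f a) (f b) (f c) (f d)) }) ,
                 (λ { c [] → zeroSum⇒badMap≡0 a b c c (zeroSum₃₄ refl a b) })) ,
               (λ { b c (d ∷ []) → badMap-cong (⊕-swap₂₃ a b c d) (⊕-swap₂₃ (f a) (f b) (f c) (f d)) }) ,
               (λ { b (d ∷ []) → zeroSum⇒badMap≡0 a b b d (zeroSum₂₃ refl a d) }))
      , (λ { a b (c ∷ d ∷ []) → badMap-cong (⊕-swap₁₂ a b c d) (⊕-swap₁₂ (f a) (f b) (f c) (f d)) })
      , (λ { a (c ∷ d ∷ []) → zeroSum⇒badMap≡0 a a c d (zeroSum₁₂ refl c d) }) )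
      where
      φ : Vec (Pt n) 4 → ℕ
      φ (a ∷ b ∷ c ∷ d ∷ []) = badMap a b c d

    ∑-bad₄ : 2 * ∑ₚ (λ v → bad₄ (dot v ∘ f)) ≡ 2 ^ n * badCount
    ∑-bad₄ = begin
      2 * ∑ₚ (λ v → bad₄ (dot v ∘ f))
        ≡⟨ cong (2 *_) (∑-∑₄-swap n (allPts n) _) ⟩
      2 * ∑₄ {n} (λ a b c d → ∑ₚ (λ v → ⟦ eqb (a ⊕ b ⊕ c ⊕ d) 𝟘 ⟧ * ⟦ dot v (f a) xor dot v (f b) xor dot v (f c) xor dot v (f d) ⟧))
        ≡⟨ *-distribˡ-∑₄ n 2 _ ⟨
      ∑₄ {n} (λ a b c d → 2 * ∑ₚ (λ v → ⟦ eqb (a ⊕ b ⊕ c ⊕ d) 𝟘 ⟧ * ⟦ dot v (f a) xor dot v (f b) xor dot v (f c) xor dot v (f d) ⟧))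
        ≡⟨ ∑₄-cong n inner ⟩
      ∑₄ {n} (λ a b c d → 2 ^ n * badMap a b c d)
        ≡⟨ *-distribˡ-∑₄ n (2 ^ n) badMap ⟩
      2 ^ n * badCount ∎
      where
      open ≡-Reasoning
      rotate : ∀ x y → 2 * (x * y) ≡ x * (2 * y)
      rotate = solve-∀
      rotate′ : ∀ x y z → x * (y * z) ≡ y * (x * z)
      rotate′ = solve-∀
      inner : ∀ a b c d → 2 * ∑ₚ (λ v → ⟦ eqb (a ⊕ b ⊕ c ⊕ d) 𝟘 ⟧ * ⟦ dot v (f a) xor dot v (f b) xor dot v (f c) xor dot v (f d) ⟧) ≡
                          2 ^ n * badMap a b c d
      inner a b c d = begin
        2 * ∑ₚ (λ v → ⟦ z ⟧ * ⟦ dot v (f a) xor dot v (f b) xor dot v (f c) xor dot v (f d) ⟧)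
          ≡⟨ cong (2 *_) (trans (∑-cong (allPts n) (λ v → cong (λ p → ⟦ z ⟧ * ⟦ p ⟧) (sym (dot-⊕₄ v (f a) (f b) (f c) (f d)))))
                                (*-distribˡ-∑ (allPts n) ⟦ z ⟧ _)) ⟩
        2 * (⟦ z ⟧ * wt (λ v → dot v s))
          ≡⟨ rotate ⟦ z ⟧ _ ⟩
        ⟦ z ⟧ * (2 * wt (λ v → dot v s))
          ≡⟨ cong (⟦ z ⟧ *_) (wt-dot s) ⟩
        ⟦ z ⟧ * (2 ^ n * ⟦ not (eqb s 𝟘) ⟧)
          ≡⟨ rotate′ ⟦ z ⟧ (2 ^ n) _ ⟩
        2 ^ n * badMap a b c d ∎
        where
        z : Bool
        z = eqb (a ⊕ b ⊕ c ⊕ d) 𝟘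
        s : Pt n
        s = f a ⊕ f b ⊕ f c ⊕ f d

    module _ (injective : ∀ {x y} → f x ≡ f y → x ≡ y) where

      badFlat? : Decidable (λ q → Is2Flat q × ¬ Is2Flat (image f q))
      badFlat? q = is2Flat? q ×-dec ¬? (is2Flat? (image f q))

      -- Injectivity keeps image points distinct, so the image of a flat can fail only through its
      -- sum. Conversely, a zero-sum quad with nonzero image sum has no coinciding points.
      badMap-flat : ∀ a b c d → ⟦ does (badFlat? (a , b , c , d)) ⟧ ≡ badMap a b c d
      badMap-flat a b c d = trans (cong ⟦_⟧ (does-⇔ (mk⇔ to from) (badFlat? (a , b , c , d)) zeroSum?)) (⟦∧⟧ (eqb (a ⊕ b ⊕ c ⊕ d) 𝟘) _)
        where
        zeroSum? : Dec (a ⊕ b ⊕ c ⊕ d ≡ 𝟘 × f a ⊕ f b ⊕ f c ⊕ f d ≢ 𝟘)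
        zeroSum? = ((a ⊕ b ⊕ c ⊕ d) ≟P 𝟘) ×-dec ¬? ((f a ⊕ f b ⊕ f c ⊕ f d) ≟P 𝟘)
        to : Is2Flat (a , b , c , d) × ¬ Is2Flat (f a , f b , f c , f d) →
             a ⊕ b ⊕ c ⊕ d ≡ 𝟘 × f a ⊕ f b ⊕ f c ⊕ f d ≢ 𝟘
        to (((ab , ac , ad , bc , bd , cd) , eq) , ¬flat) = eq , λ eq′ →
          ¬flat ((ab ∘ injective , ac ∘ injective , ad ∘ injective , bc ∘ injective , bd ∘ injective , cd ∘ injective) , eq′)
        from : a ⊕ b ⊕ c ⊕ d ≡ 𝟘 × f a ⊕ f b ⊕ f c ⊕ f d ≢ 𝟘 →
               Is2Flat (a , b , c , d) × ¬ Is2Flat (f a , f b , f c , f d)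
        from (eq , neq) =
          (( (λ e → neq (zeroSum₁₂ e c d eq)) , (λ e → neq (zeroSum₁₃ e b d eq)) , (λ e → neq (zeroSum₁₄ e b c eq))
           , (λ e → neq (zeroSum₂₃ e a d eq)) , (λ e → neq (zeroSum₂₄ e a c eq)) , (λ e → neq (zeroSum₃₄ e a b eq))) , eq)
          , λ flat → neq (proj₂ flat)
        ⟦∧⟧ : ∀ p q → ⟦ p ∧ q ⟧ ≡ ⟦ p ⟧ * ⟦ q ⟧
        ⟦∧⟧ false q = refl
        ⟦∧⟧ true  q = sym (ℕₚ.+-identityʳ ⟦ q ⟧)

      length-badFlats : length (filter badFlat? (allQuads n)) ≡ badCount
      length-badFlats =
        trans (length-filter-concatMap badFlat? _ P) (∑-cong P (λ a →
          trans (length-filter-concatMap badFlat? _ P) (∑-cong P (λ b →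
            trans (length-filter-concatMap badFlat? _ P) (∑-cong P (λ c →
              trans (length-filter-map badFlat? (λ d → a , b , c , d) P) (∑-cong P (badMap-flat a b c))))))))
        where
        P : List (Pt n)
        P = allPts n

-- Permutations

Aff-cong : ∀ {n} (g : Pt n → Bool) {h} → (∀ x → g x ≡ h x) → Aff g → Aff h
Aff-cong g eq aff a b c = trans (sym (eq _)) (trans (aff a b c) (cong₂ _xor_ (cong₂ _xor_ (eq a) (eq b)) (eq c)))

Aff-xor : ∀ {n} (g h : Pt n → Bool) → Aff g → Aff h → Aff (λ x → g x xor h x)
Aff-xor g h aff-g aff-h a b c =
  trans (cong₂ _xor_ (aff-g a b c) (aff-h a b c))
    (trans (xor-interchange (g a xor g b) (g c) (h a xor h b) (h c))
      (cong (_xor (g c xor h c)) (xor-interchange (g a) (g b) (h a) (h b))))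

Aff⇒zero-sum : ∀ {n} (g : Pt n → Bool) → Aff g → ∀ {a b c d} → a ⊕ b ⊕ c ⊕ d ≡ 𝟘 → g a xor g b xor g c xor g d ≡ false
Aff⇒zero-sum g aff {a} {b} {c} {d} eq =
  trans (cong₂ _xor_ (sym (aff a b c)) (cong g (sym (⊕≡𝟘⇒≡ eq)))) (Boolₚ.xor-same (g (a ⊕ b ⊕ c)))

AffMap⇒zero-sum : ∀ {m n} {L : Pt m → Pt n} → AffMap L → ∀ {a b c d} → a ⊕ b ⊕ c ⊕ d ≡ 𝟘 → L a ⊕ L b ⊕ L c ⊕ L d ≡ 𝟘
AffMap⇒zero-sum {L = L} aff {a} {b} {c} {d} eq =
  trans (cong₂ _⊕_ (sym (aff a b c)) (cong L (sym (⊕≡𝟘⇒≡ eq)))) (⊕-self (L (a ⊕ b ⊕ c)))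

Aff⇒bad₄≡0 : ∀ {n} (g : Pt n → Bool) → Aff g → bad₄ g ≡ 0
Aff⇒bad₄≡0 {n} g aff = trans (∑₄-cong n vanish)
  (trans (∑-cong P (λ _ → trans (∑-cong P (λ _ → trans (∑-cong P (λ _ → ∑-zero P)) (∑-zero P))) (∑-zero P))) (∑-zero P))
  where
  P : List (Pt n)
  P = allPts n
  vanish : ∀ a b c d → ⟦ eqb (a ⊕ b ⊕ c ⊕ d) 𝟘 ⟧ * ⟦ g a xor g b xor g c xor g d ⟧ ≡ 0
  vanish a b c d with (a ⊕ b ⊕ c ⊕ d) ≟P 𝟘
  ... | no _   = refl
  ... | yes eq = cong (λ p → ⟦ p ⟧ + 0) (Aff⇒zero-sum g aff {a} eq)

bad₄>0⇒∃ : ∀ {n} (g : Pt n → Bool) → 0 < bad₄ g →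
  ∃ λ a → ∃ λ b → ∃ λ c → ∃ λ d → a ⊕ b ⊕ c ⊕ d ≡ 𝟘 × g a xor g b xor g c xor g d ≡ true
bad₄>0⇒∃ {n} g lt =
  let a , lt-a = ∑>0⇒∃>0 (allPts n) lt
      b , lt-b = ∑>0⇒∃>0 (allPts n) lt-a
      c , lt-c = ∑>0⇒∃>0 (allPts n) lt-b
      d , lt-d = ∑>0⇒∃>0 (allPts n) lt-c
      z , s    = both (eqb (a ⊕ b ⊕ c ⊕ d) 𝟘) (g a xor g b xor g c xor g d) lt-d
  in a , b , c , d , eqb-sound {x = a ⊕ b ⊕ c ⊕ d} z , s
  where
  both : ∀ p q → 0 < ⟦ p ⟧ * ⟦ q ⟧ → p ≡ true × q ≡ true
  both true true _ = refl , refl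

⊕-adjoint : ∀ {n} (x d y : Pt n) → eqb (x ⊕ d) y ≡ eqb x (y ⊕ d)
⊕-adjoint x d y = eqb-cong-⇔ {x = x ⊕ d} (λ { refl → sym (⊕-cancelʳ x d) }) (λ { refl → ⊕-cancelʳ y d })

module Permutation {n : ℕ} (r : ℕ) (1≤r : 1 ≤ r) (card : 2 ^ n ≡ 4 * suc r)
  (F G : Pt n → Pt n) (FG : ∀ y → F (G y) ≡ y) (GF : ∀ x → G (F x) ≡ x) where

  open EvenWeight {n} r 1≤r card

  private
    P : List (Pt n)
    P = allPts n

  F-injective : ∀ {x y} → F x ≡ F y → x ≡ y
  F-injective {x} {y} eq = trans (sym (GF x)) (trans (cong G eq) (GF y))

  wt-∘ : ∀ h → wt (h ∘ F) ≡ wt h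
  wt-∘ h = ∑ₚ-permute F G (λ x y → eqb-cong-⇔ {x = F x} (λ eq → trans (sym (GF x)) (cong G eq))
                                     (λ eq → trans (cong F eq) (FG y))) (λ x → ⟦ h x ⟧)

  0<K : 0 < K
  0<K = ℕₚ.*-mono-≤ {1} {64} (s≤s z≤n) (ℕₚ.*-mono-≤ 1≤r (ℕₚ.m≤n+m 1 (2 * r)))

  Big : (Pt n → Bool) → Set
  Big g = K ≤ bad₄ g × (bad₄ g ≡ K → ∃ λ c → ∃ λ u → wt (λ x → c xor (g x xor dot u x)) ≡ 2)

  Big⇒¬Aff : ∀ g → Big g → ¬ Aff g
  Big⇒¬Aff g (K≤ , _) aff = ℕₚ.<⇒≱ 0<K (ℕₚ.≤-trans K≤ (ℕₚ.≤-reflexive (Aff⇒bad₄≡0 g aff)))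

  component : Pt n → Pt n → Bool
  component v x = dot v (F x)

  -- Composition with a permutation preserves weight, so the component has the weight of a linear
  -- form, 0 or 2R, and the gap for even weight applies.
  dichotomy : ∀ v → Aff (component v) ⊎ Big (component v)
  dichotomy v = Amplitudes.bad₄-gap (component v) (approximation (component v)
    (subst (2 ∣_) (sym (trans (wt-∘ (dot v)) (wt-dotˡ v))) (m∣m*n (suc r * ⟦ not (eqb v 𝟘) ⟧))))

  component-⊕ : ∀ v w x → component (v ⊕ w) x ≡ component v x xor component w x
  component-⊕ v w x = dot-⊕ˡ v w (F x)

  module NonAffine (v₀ : Pt n) (big₀ : Big (component v₀)) where

    Aff-pair : ∀ v → Aff (component v) → ¬ Aff (component (v ⊕ v₀))
    Aff-pair v aff aff′ = Big⇒¬Aff (component v₀) big₀ (Aff-cong _ (λ x → trans (sym (component-⊕ v (v ⊕ v₀) x))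
      (cong (λ w → component w x) (⊕-cancelˡ v v₀))) (Aff-xor (component v) (component (v ⊕ v₀)) aff aff′))

    pair-≥ : ∀ v → K ≤ bad₄ (component v) + bad₄ (component (v ⊕ v₀))
    pair-≥ v = cases (dichotomy v) (dichotomy (v ⊕ v₀))
      where
      cases : Aff (component v) ⊎ Big (component v) → Aff (component (v ⊕ v₀)) ⊎ Big (component (v ⊕ v₀)) →
              K ≤ bad₄ (component v) + bad₄ (component (v ⊕ v₀))
      cases (inj₂ (K≤ , _)) _               = ℕₚ.≤-trans K≤ (ℕₚ.m≤m+n _ _)
      cases (inj₁ _)        (inj₂ (K≤ , _)) = ℕₚ.≤-trans K≤ (ℕₚ.m≤n+m _ _)
      cases (inj₁ aff)      (inj₁ aff′)     = contradiction aff′ (Aff-pair v aff)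

    -- Translation by `v₀` permutes the vectors, so both halves have the same sum, which accounts
    -- for the factor 2 in `∑-bad₄`.
    ∑-pairs : ∑ₚ (λ v → bad₄ (component v) + bad₄ (component (v ⊕ v₀))) ≡ 2 ^ n * badCount F
    ∑-pairs = trans (∑-distrib-+ P _ _)
      (trans (cong (S +_) (trans (∑ₚ-permute (_⊕ v₀) (_⊕ v₀) (λ x y → ⊕-adjoint x v₀ y) (λ v → bad₄ (component v)))
          (sym (ℕₚ.+-identityʳ S))))
        (∑-bad₄ F))
      where
      S : ℕ
      S = ∑ₚ (λ v → bad₄ (component v))

    K≤badCount : K ≤ badCount F
    K≤badCount = ℕₚ.*-cancelˡ-≤ (4 * suc r) (subst (λ N → N * K ≤ N * badCount F) card
      (subst₂ _≤_ (∑ₚ-const n K) ∑-pairs (∑-mono-≤ P pair-≥)))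

    module Equality (eq : badCount F ≡ K) where

      -- Every pair contributes at least `K`, and in total they contribute N·K, so no pair can
      -- exceed `K`.
      pair-≡ : ∀ v → bad₄ (component v) + bad₄ (component (v ⊕ v₀)) ≡ K
      pair-≡ v = ℕₚ.≤-antisym (ℕₚ.≮⇒≥ λ K< → ℕₚ.<-irrefl
        (trans (∑ₚ-const n K) (trans (cong (2 ^ n *_) (sym eq)) (sym ∑-pairs)))
        (∑-mono-< pair-≥ (∈-allPts v) K<)) (pair-≥ v)

      bad₀ : bad₄ (component v₀) ≡ K
      bad₀ = ℕₚ.≤-antisym (ℕₚ.≤-trans (ℕₚ.m≤m+n _ _) (ℕₚ.≤-reflexive (pair-≡ v₀))) (proj₁ big₀)

      one-Aff : ∀ v → Aff (component v) ⊎ Aff (component (v ⊕ v₀))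
      one-Aff v = cases (dichotomy v) (dichotomy (v ⊕ v₀))
        where
        cases : Aff (component v) ⊎ Big (component v) → Aff (component (v ⊕ v₀)) ⊎ Big (component (v ⊕ v₀)) →
                Aff (component v) ⊎ Aff (component (v ⊕ v₀))
        cases (inj₁ aff)      _                = inj₁ aff
        cases (inj₂ _)        (inj₁ aff)       = inj₂ aff
        cases (inj₂ (K≤ , _)) (inj₂ (K≤′ , _)) = contradiction
          (ℕₚ.≤-trans (ℕₚ.+-mono-≤ K≤ K≤′) (ℕₚ.≤-reflexive (pair-≡ v))) (ℕₚ.<⇒≱ (ℕₚ.m<m+n K 0<K))

      private
        near : ∃ λ c → ∃ λ u → wt (λ x → c xor (component v₀ x xor dot u x)) ≡ 2
        near = proj₂ big₀ bad₀
        sign : Bool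
        sign = proj₁ near
        u : Pt n
        u = proj₁ (proj₂ near)
        points : ∃ λ a → ∃ λ b → a ≢ b × (∀ x → sign xor (component v₀ x xor dot u x) ≡ eqb x a xor eqb x b)
        points = wt≡2⇒pair _ (proj₂ (proj₂ near))

      a b : Pt n
      a = proj₁ points
      b = proj₁ (proj₂ points)

      a≢b : a ≢ b
      a≢b = proj₁ (proj₂ (proj₂ points))

      h : Pt n → Bool
      h x = eqb x a xor eqb x b

      h≡ : ∀ x → sign xor (component v₀ x xor dot u x) ≡ h x
      h≡ = proj₂ (proj₂ (proj₂ points))

      -- A component v·F is affine or differs from v₀·F by an affine function, so the sums of F over
      -- zero-sum quads lie in {0, e}, where e is its sum over any quad that is bad for v₀·F.
      private
        quad : ∃ λ p → ∃ λ q → ∃ λ s → ∃ λ t → p ⊕ q ⊕ s ⊕ t ≡ 𝟘 ×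
               component v₀ p xor component v₀ q xor component v₀ s xor component v₀ t ≡ true
        quad = bad₄>0⇒∃ (component v₀) (subst (0 <_) (sym bad₀) 0<K)
        p q s t : Pt n
        p = proj₁ quad
        q = proj₁ (proj₂ quad)
        s = proj₁ (proj₂ (proj₂ quad))
        t = proj₁ (proj₂ (proj₂ (proj₂ quad)))

      e : Pt n
      e = F p ⊕ F q ⊕ F s ⊕ F t

      v₀·e : dot v₀ e ≡ true
      v₀·e = trans (dot-⊕₄ v₀ (F p) (F q) (F s) (F t)) (proj₂ (proj₂ (proj₂ (proj₂ (proj₂ quad)))))

      Aff⇒·e : ∀ v → Aff (component v) → dot v e ≡ false
      Aff⇒·e v aff = trans (dot-⊕₄ v (F p) (F q) (F s) (F t))
        (Aff⇒zero-sum (component v) aff {p} (proj₁ (proj₂ (proj₂ (proj₂ (proj₂ quad))))))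

      L : Pt n → Pt n
      L x = F x ⊕ h x · e

      dot-L : ∀ v x → dot v (L x) ≡ component v x xor (h x ∧ dot v e)
      dot-L v x = trans (dot-⊕ʳ v (F x) (h x · e)) (cong (component v x xor_) (dot-· v (h x) e))

      -- If v·F is affine, then v·e = 0 and v·L = v·F. Otherwise (v + v₀)·F is affine and v·e = 1;
      -- then v·L = v·F + h is the sum of (v + v₀)·F and the affine function that agrees with v₀·F
      -- off a and b.
      L-component-aff : ∀ v → Aff (dot v ∘ L)
      L-component-aff v = [ direct , shifted ]′ (one-Aff v)
        where
        direct : Aff (component v) → Aff (dot v ∘ L)
        direct aff = Aff-cong (component v) (λ x → sym (trans (dot-L v x)
              (trans (cong (component v x xor_) (trans (cong (h x ∧_) (Aff⇒·e v aff)) (Boolₚ.∧-zeroʳ (h x))))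
                (Boolₚ.xor-identityʳ _)))) aff
        shifted : Aff (component (v ⊕ v₀)) → Aff (dot v ∘ L)
        shifted aff = Aff-cong _ value (Aff-xor (component (v ⊕ v₀)) (λ x → sign xor dot u x) aff
              (λ x y z → trans (cong (sign xor_) (dot-⊕₃ u x y z)) (xor-affine sign _ _ _)))
          where
          v·e : dot v e ≡ true
          v·e = trans (xor≡false⇒≡ (trans (sym (dot-⊕ˡ v v₀ e)) (Aff⇒·e (v ⊕ v₀) aff))) v₀·e
          rearrange : ∀ a b c d → (a xor b) xor (c xor d) ≡ a xor (c xor (b xor d))
          rearrange a b c d = trans (xor-interchange a b c d) (Boolₚ.xor-assoc a c (b xor d))
          value : ∀ x → component (v ⊕ v₀) x xor (sign xor dot u x) ≡ dot v (L x)
          value x = trans (cong (_xor (sign xor dot u x)) (component-⊕ v v₀ x))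
            (trans (rearrange (component v x) (component v₀ x) sign (dot u x))
              (trans (cong (component v x xor_) (trans (h≡ x) (sym (trans (cong (h x ∧_) v·e) (Boolₚ.∧-identityʳ (h x))))))
                (sym (dot-L v x))))

      L-aff : AffMap L
      L-aff = AffMap-dot L-component-aff

      h≡false⇒L≡F : ∀ {x} → h x ≡ false → L x ≡ F x
      h≡false⇒L≡F {x} eq = trans (cong (λ i → F x ⊕ i · e) eq) (⊕-identityʳ (F x))

      -- At most four points y have y or y + d in {a, b}, and there are N ≥ 8 points.
      avoid : ∀ d → ∃ λ y → h y ≡ false × h (y ⊕ d) ≡ false
      avoid d =
        let y , lt = ∑<∑⇒∃< {f = λ y → (⟦ eqb y a ⟧ + ⟦ eqb y b ⟧) + (⟦ eqb (y ⊕ d) a ⟧ + ⟦ eqb (y ⊕ d) b ⟧)} {g = λ _ → 1} P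
                       (subst₂ _<_ (sym four) (sym (trans (∑ₚ-1 n) card)) (ℕₚ.<-≤-trans (ℕₚ.m<m+n 4 {4} (s≤s z≤n)) (ℕₚ.*-monoʳ-≤ 4 (s≤s 1≤r))))
        in y , none (eqb y a) (eqb y b) (eqb (y ⊕ d) a) (eqb (y ⊕ d) b) lt
        where
        four : ∑ₚ (λ y → (⟦ eqb y a ⟧ + ⟦ eqb y b ⟧) + (⟦ eqb (y ⊕ d) a ⟧ + ⟦ eqb (y ⊕ d) b ⟧)) ≡ 4
        four = trans (∑-distrib-+ P _ _) (cong₂ _+_
          (trans (∑-distrib-+ P _ _) (cong₂ _+_ (wt-eqb a) (wt-eqb b)))
          (trans (∑-distrib-+ P _ _) (cong₂ _+_ (shifted a) (shifted b))))
          where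
          shifted : ∀ c → wt (λ y → eqb (y ⊕ d) c) ≡ 1
          shifted c = trans (wt-cong (λ y → ⊕-adjoint y d c)) (wt-eqb (c ⊕ d))
        none : ∀ i j k l → (⟦ i ⟧ + ⟦ j ⟧) + (⟦ k ⟧ + ⟦ l ⟧) < 1 → i xor j ≡ false × k xor l ≡ false
        none false false false false _ = refl , refl
        none false false false true  (s≤s ())
        none false false true  l     (s≤s ())
        none false true  k     l     (s≤s ())
        none true  j     k     l     (s≤s ())

      -- A collision of the affine map `L` at x, y recurs at z, z + (x + y) for every z. For z
      -- chosen by `avoid`, `L` agrees with the injective `F` at both points.
      L-injective : ∀ {x y} → L x ≡ L y → x ≡ y
      L-injective {x} {y} Lx≡Ly =
        let z , hz , hz′ = avoid (x ⊕ y)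
            same : L (z ⊕ (x ⊕ y)) ≡ L z
            same = trans (cong L (sym (⊕-assoc z x y))) (trans (L-aff z x y)
                     (trans (cong (λ w → L z ⊕ L x ⊕ w) (sym Lx≡Ly)) (⊕-cancelʳ (L z) (L x))))
            fixed : z ⊕ (x ⊕ y) ≡ z
            fixed = F-injective (trans (sym (h≡false⇒L≡F hz′)) (trans same (h≡false⇒L≡F hz)))
        in ⊕≡𝟘⇒≡ (trans (sym (⊕-cancelˡ z (x ⊕ y))) (trans (cong (z ⊕_) fixed) (⊕-self z)))

      e≢𝟘 : e ≢ 𝟘
      e≢𝟘 eq = contradiction (trans (sym v₀·e) (trans (cong (dot v₀) eq) (trans (dot-comm v₀ 𝟘) (dot-𝟘ˡ v₀)))) λ ()

      -- Let c be the point with `F c` = `L b`. Outside {a, b} it would also satisfy `L c` = `L b`,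
      -- forcing c = b; and c = b would give e = 0. Only c = a remains.
      Fa≡Lb : F a ≡ L b
      Fa≡Lb = cases (G (L b) ≟P a) (G (L b) ≟P b)
        where
        hb : h b ≡ true
        hb = cong₂ _xor_ (eqb-≢ (a≢b ∘ sym)) (eqb-refl b)
        cases : Dec (G (L b) ≡ a) → Dec (G (L b) ≡ b) → F a ≡ L b
        cases (yes c≡a) _         = trans (cong F (sym c≡a)) (FG (L b))
        cases (no _)    (yes c≡b) = contradiction
          (trans (sym (⊕-cancelˡ (F b) e)) (trans (cong (λ i → F b ⊕ (F b ⊕ i · e)) (sym hb))
            (trans (cong (F b ⊕_) (trans (sym (FG (L b))) (cong F c≡b))) (⊕-self (F b))))) e≢𝟘
        cases (no c≢a)  (no c≢b)  = contradiction
          (L-injective (trans (h≡false⇒L≡F (cong₂ _xor_ (eqb-≢ c≢a) (eqb-≢ c≢b))) (FG (L b)))) c≢b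

      La⊕Lb≡e : L a ⊕ L b ≡ e
      La⊕Lb≡e = trans (cong₂ _⊕_ (trans (cong (λ i → F a ⊕ i · e) (cong₂ _xor_ (eqb-refl a) (eqb-≢ a≢b))) (⊕-comm (F a) e))
                                  (sym Fa≡Lb)) (⊕-cancelʳ e (F a))

      F≡L∘swap : ∀ x → L (swap a b x) ≡ F x
      F≡L∘swap x = trans (cong L (swap-⊕ a≢b x)) (trans (AffMap-· L-aff x (h x) a b)
        (trans (cong (λ w → L x ⊕ h x · w) La⊕Lb≡e) (⊕-cancelʳ (F x) (h x · e))))

      M : Pt n → Pt n
      M y = swap a b (G y)

      LM : ∀ y → L (M y) ≡ y
      LM y = trans (F≡L∘swap (G y)) (FG y)

      ML : ∀ x → M (L x) ≡ x
      ML x = L-injective (LM (L x))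

      inDoubleCoset : ∀ {a′ b′} → a′ ≢ b′ → InDoubleCoset (swap a′ b′) F
      inDoubleCoset {a′} {b′} a′≢b′ =
        let γ , γa , γb = two-transitive a≢b a′≢b′
            open AffineBijection γ
            from-aff : AffMap from
            from-aff = AffMap-inverse to-aff to-from from-to
            injective : ∀ {x y} → to x ≡ to y → x ≡ y
            injective {x} {y} eq = trans (sym (from-to x)) (trans (cong from eq) (from-to y))
            conjugate : ∀ x → from (swap a′ b′ (to x)) ≡ swap a b x
            conjugate x = trans (cong from (trans (cong₂ (λ c d → swap c d (to x)) (sym γa) (sym γb))
              (sym (swap-conjugate to-aff injective a≢b x)))) (from-to (swap a b x))
        -- Conjugation by γ turns the transposition found into the prescribed one, so `from` is
        -- absorbed into the left affine factor.
        in L ∘ from , to ,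
           AffMap⇒IsAffine (L ∘ from) (to ∘ M) (AffMap-∘ {L = L} L-aff from-aff)
             (λ y → trans (cong L (from-to (M y))) (LM y)) (λ x → trans (cong to (ML (from x))) (to-from x)) ,
           AffMap⇒IsAffine to from to-aff to-from from-to ,
           λ x → sym (trans (cong L (conjugate x)) (F≡L∘swap x))

  nonAffine : ¬ IsAffine F → ∃ λ v → Big (component v)
  nonAffine ¬affine = [ (λ aff → contradiction (AffMap⇒IsAffine F G (AffMap-dot aff) FG GF) ¬affine) , id ]′ (∀⊎∃ dichotomy)

-- Transpositions attain the bound

module Transposition {n : ℕ} (r : ℕ) (1≤r : 1 ≤ r) (card : 2 ^ n ≡ 4 * suc r)
  {a b : Pt n} (a≢b : a ≢ b) {α β F : Pt n → Pt n} (α-affine : IsAffine α) (β-affine : IsAffine β)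
  (F≡ : ∀ x → F x ≡ α (swap a b (β x))) where

  open EvenWeight {n} r 1≤r card

  private
    module α = Affine α-affine
    module β = Affine β-affine
    h : Pt n → Bool
    h x = eqb (β x) a xor eqb (β x) b
    e : Pt n
    e = α a ⊕ α b

  e≢𝟘 : e ≢ 𝟘
  e≢𝟘 eq = a≢b (trans (sym (α.inverseˡ a)) (trans (cong α.inv (⊕≡𝟘⇒≡ eq)) (α.inverseˡ b)))

  F-⊕ : ∀ x → F x ≡ α (β x) ⊕ h x · e
  F-⊕ x = trans (F≡ x) (trans (cong α (swap-⊕ a≢b (β x))) (AffMap-· α.affMap (β x) (h x) a b))

  wt-h : wt h ≡ 2
  wt-h = trans (Permutation.wt-∘ r 1≤r card β β.inv β.inverseʳ β.inverseˡ (λ y → eqb y a xor eqb y b)) (wt-pair a≢b)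

  -- On a zero-sum quad the affine part α ∘ β cancels, leaving the parity of `h` times the nonzero
  -- vector `e`. So `F` is bad exactly where the single Boolean function `h` of weight 2 is.
  badMap≡ : ∀ p q s t → badMap F p q s t ≡ ⟦ eqb (p ⊕ q ⊕ s ⊕ t) 𝟘 ⟧ * ⟦ h p xor h q xor h s xor h t ⟧
  badMap≡ p q s t with (p ⊕ q ⊕ s ⊕ t) ≟P 𝟘
  ... | no _   = refl
  ... | yes eq = cong (λ i → ⟦ i ⟧ + 0) (trans (cong (λ w → not (eqb w 𝟘)) sum) (nonzero (h p xor h q xor h s xor h t)))
    where
    L : Pt n → Pt n
    L = α ∘ β
    regroup : F p ⊕ F q ⊕ F s ⊕ F t ≡ (L p ⊕ L q ⊕ L s ⊕ L t) ⊕ (h p · e ⊕ h q · e ⊕ h s · e ⊕ h t · e)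
    regroup = trans (cong₂ _⊕_ (cong₂ _⊕_ (cong₂ _⊕_ (F-⊕ p) (F-⊕ q)) (F-⊕ s)) (F-⊕ t))
      (trans (cong (_⊕ (L t ⊕ h t · e)) (trans (cong (_⊕ (L s ⊕ h s · e)) (⊕-interchange (L p) (h p · e) (L q) (h q · e)))
        (⊕-interchange (L p ⊕ L q) (h p · e ⊕ h q · e) (L s) (h s · e))))
        (⊕-interchange (L p ⊕ L q ⊕ L s) (h p · e ⊕ h q · e ⊕ h s · e) (L t) (h t · e)))
    sum : F p ⊕ F q ⊕ F s ⊕ F t ≡ (h p xor h q xor h s xor h t) · e
    sum = trans regroup (trans (cong₂ _⊕_ (AffMap⇒zero-sum (AffMap-∘ {L = α} α.affMap β.affMap) {p} eq)
      (sym (trans (·-xor (h p xor h q xor h s) (h t) e) (cong (_⊕ h t · e)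
        (trans (·-xor (h p xor h q) (h s) e) (cong (_⊕ h s · e) (·-xor (h p) (h q) e)))))))
      (⊕-identityˡ _))
    nonzero : ∀ i → not (eqb (i · e) 𝟘) ≡ i
    nonzero false = cong not (eqb-refl {n} 𝟘)
    nonzero true  = cong not (eqb-≢ e≢𝟘)

  badCount≡K : badCount F ≡ K
  badCount≡K = trans (∑₄-cong n badMap≡)
    (Amplitudes.wt≡2⇒bad₄≡K h (approximation h (subst (2 ∣_) (sym wt-h) (m∣m*n 1))) wt-h)

-- From ordered quads to the coaffinity

coaffinity2*24 : ∀ {n} (f : Pt n → Pt n) → (∀ {x y} → f x ≡ f y → x ≡ y) → coaffinity2 f * 24 ≡ badCount f
coaffinity2*24 f injective =
  trans (cong (λ k → k / 24 * 24) (length-badFlats f injective)) (m/n*n≡m (24∣badCount f))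

-- With the denominator 3 cleared, the two sides of the claim are one eighth of `K` and of the count
-- of ordered bad quads.
module Scaling (c A B r : ℕ) {bad K : ℕ} (bad≡ : c * 24 ≡ bad) (K≡ : K ≡ 64 * (r * (2 * r + 1)))
         (A≡ : A ≡ 2 * r + 1) (B≡ : B ≡ r) where

  private
    8*3c : 8 * (3 * c) ≡ bad
    8*3c = trans (regroup c) bad≡
      where
      regroup : ∀ c → 8 * (3 * c) ≡ c * 24
      regroup = solve-∀

    8*8AB : 8 * (8 * (A * B)) ≡ K
    8*8AB = trans (cong₂ (λ x y → 8 * (8 * (x * y))) A≡ B≡) (trans (regroup r) (sym K≡))
      where
      regroup : ∀ r → 8 * (8 * ((2 * r + 1) * r)) ≡ 64 * (r * (2 * r + 1))
      regroup = solve-∀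

  scale-≤ : K ≤ bad → 8 * (A * B) ≤ 3 * c
  scale-≤ K≤bad = ℕₚ.*-cancelˡ-≤ 8 (subst₂ _≤_ (sym 8*8AB) (sym 8*3c) K≤bad)

  scale-≡ : bad ≡ K → 3 * c ≡ 8 * (A * B)
  scale-≡ bad≡K = ℕₚ.*-cancelˡ-≡ (3 * c) (8 * (A * B)) 8 (trans 8*3c (trans bad≡K (sym 8*8AB)))

  unscale-≡ : 3 * c ≡ 8 * (A * B) → bad ≡ K
  unscale-≡ eq = trans (sym 8*3c) (trans (cong (8 *_) eq) 8*8AB)

theorem7p2 : (n : ℕ) → 3 ≤ n → (f : Pt n ↔ Pt n) → ¬ IsAffine (Inverse.to f) →
    (8 * ((2 ^ (n ∸ 1) ∸ 1) * (2 ^ (n ∸ 2) ∸ 1)) ≤ 3 * coaffinity2 (Inverse.to f))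
    × ((a b : Pt n) → a ≢ b →
    (3 * coaffinity2 (Inverse.to f) ≡ 8 * ((2 ^ (n ∸ 1) ∸ 1) * (2 ^ (n ∸ 2) ∸ 1))
    ⇔ InDoubleCoset (swap a b) (Inverse.to f)))
theorem7p2 n@(suc (suc (suc m))) (s≤s (s≤s (s≤s z≤n))) f ¬affine =
  scale-≤ K≤badCount ,
  λ a b a≢b → mk⇔
    (λ eq → Equality.inDoubleCoset (unscale-≡ eq) a≢b)
    (λ { (α , β , α-affine , β-affine , F≡) → scale-≡ (Transposition.badCount≡K r 1≤r card a≢b α-affine β-affine F≡) })
  where
  F G : Pt n → Pt n
  F = Inverse.to f
  G = Inverse.from f
  r : ℕ
  -- N/4 is `2 ^ suc m`, so r is at the same time the factor 2^(n-2) - 1 of the bound; n ≥ 3 makes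
  -- it positive.
  r = 2 ^ suc m ∸ 1
  2≤2^ : 2 ≤ 2 ^ suc m
  2≤2^ = ℕₚ.*-monoʳ-≤ 2 (ℕₚ.m^n>0 2 m)
  1+r : suc r ≡ 2 ^ suc m
  1+r = ℕₚ.m+[n∸m]≡n (ℕₚ.<⇒≤ 2≤2^)
  1≤r : 1 ≤ r
  1≤r = ℕₚ.∸-monoˡ-≤ 1 2≤2^
  card : 2 ^ n ≡ 4 * suc r
  card = trans (sym (ℕₚ.*-assoc 2 2 (2 ^ suc m))) (cong (4 *_) (sym 1+r))
  A≡ : 2 ^ suc (suc m) ∸ 1 ≡ 2 * r + 1
  A≡ = cong (_∸ 1) (trans (cong (2 *_) (sym 1+r)) (expand r))
    where
    expand : ∀ r → 2 * (1 + r) ≡ 1 + (2 * r + 1)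
    expand = solve-∀
  open Permutation r 1≤r card F G (Inverse.strictlyInverseˡ f) (Inverse.strictlyInverseʳ f)
  open NonAffine (proj₁ (nonAffine ¬affine)) (proj₂ (nonAffine ¬affine))
  count≡ : coaffinity2 F * 24 ≡ badCount F
  count≡ = coaffinity2*24 F F-injective
  open Scaling (coaffinity2 F) (2 ^ suc (suc m) ∸ 1) r r count≡ refl A≡ refl
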